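{- Let $Q\in\mathbb N$ and $N\in\mathbb N$ with $N\ge 1$, and let $\mathcal A$ be a closed well-typed program of type $(\mathsf{int}\to\mathsf{int}\ \mathsf{option})\to\mathsf{bool}$. Then for every state $\sigma$, $$\Big|\ \mathrm{exec}\big(\mathcal A\,(\mathsf{bounded}\ Q\ (\mathsf{rp}\ N)),\sigma\big)(\mathsf{true})\;-\;\mathrm{exec}\big(\mathcal A\,(\mathsf{bounded}\ Q\ (\mathsf{rf}\ N)),\sigma\big)(\mathsf{true})\ \Big|\ \le\ \frac{Q(Q-1)}{2N}.$$ That is, an adversary asking at most $Q$ queries distinguishes the random permutation from the random function with advantage at most $Q(Q-1)/(2N)$.
   Context: **Distributions.** A (sub)distribution on a countable set $A$ is $\mu:A\to[0,1]$ with $\sum_a\mu(a)\le 1$. **Language.** A call-by-value ML-like language. Values: integers, booleans, unit $()$, heap locations $\ell$, tape labels $\iota$, recursive functions $\mathsf{rec}\,f\,x=e$ (written $\lambda x.e$ if $f$ is unused), pairs, $\mathsf{inl}\,v$, $\mathsf{inr}\,v$. Expressions: values, variables, application, arithmetic and comparison, conditionals, pairs/projections, sums/case, $\mathsf{ref}\,e$ (allocation), $!e$, $e_1\leftarrow e_2$, $\mathsf{rand}\,e$, $\mathsf{tape}\,e$, $\mathsf{rand}\,e_1\,e_2$, and the usual introduction/elimination forms for universal, existential and recursive types. Options are $\mathsf{None}=\mathsf{inl}\,()$, $\mathsf{Some}\,v=\mathsf{inr}\,v$; lists and finite maps are encoded in the usual way. A state $\sigma$ is a pair of a finite heap $Loc\rightharpoonup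 Val$ and a finite tape store $Lbl\rightharpoonup\{(N,\vec n):N\in\mathbb N,\ \vec n\in\{0,\dots,N\}^*\}$. **Semantics.** $\mathrm{step}(e,\sigma)$ is a subdistribution on configurations (expression, state); reduction is under right-to-left call-by-value evaluation contexts. All non-probabilistic constructs step deterministically as usual (fresh locations and labels are a function of the state). $\mathsf{rand}\,N$ steps to each $n\in\{0,\dots,N\}$ with probability $1/(N+1)$, leaving the state unchanged. $\mathsf{tape}\,N$ allocates a fresh label with the empty tape $(N,\epsilon)$. $\mathsf{rand}\,N\,\iota$: if tape $\iota$ is $(N,n::w)$ it deterministically returns $n$ and leaves $(N,w)$; if it is $(N,\epsilon)$ it behaves as $\mathsf{rand}\,N$. Negative bounds are treated as $0$. Stuck configurations have the zero step distribution. $\mathrm{exec}_0(e,\sigma)(v)=1$ if $e=v$ is a value and $0$ otherwise; $\mathrm{exec}_{m+1}(e,\sigma)(v)=1$ if $e=v$ is a value, $0$ if $e$ is a value other than $v$, and otherwise $\sum_{(e',\sigma')}\mathrm{step}(e,\sigma)(e',\sigma')\cdot\mathrm{exec}_m(e',\sigma')(v)$. $\mathrm{exec}(e,\sigma)(v)=\lim_n\mathrm{exec}_n(e,\sigma)(v)$. **Typing.** Types are $\alpha,\mathsf{unit},\mathsf{bool},\mathsf{nat},\mathsf{int},\tau\times\tau,\tau+\tau,\tau\to\tau,\forall\alpha.\tau,\exists\alpha.\tau,\mu\alpha.\tau,\mathsf{ref}\,\tau,\mathsf{tape}$, with the standard ML/System-F-style typing rules; $\tau\ \mathsf{option}=\mathsf{unit}+\tau$.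 Locations and labels are not typeable as source values. "Closed well-typed" means typeable in the empty contexts. **Programs.** - $\mathsf{bounded}\ Q\ f$: allocates a counter reference $c$ initialised to $0$, and returns $\lambda x.\ \mathsf{if}\ !c<Q\ \mathsf{then}\ (c\leftarrow !c+1;\ \mathsf{Some}(f\,x))\ \mathsf{else}\ \mathsf{None}$. - $\mathsf{rf}\ N$: allocates a reference $m$ to an initially empty finite map and returns the function that on argument $x$ does the following: if $x$ is not in the domain of the map, it samples $y=\mathsf{rand}\,(N-1)$ and updates the map by $x\mapsto y$; in all cases it then returns the value the map assigns to $x$. - $\mathsf{rp}\ N$: allocates a reference $m$ to an initially empty finite map and a reference $u$ to the list $[0,1,\dots,N-1]$ of unused values, and returns the function that on argument $x$ does the following: if $x$ is not in the domain of the map, it samples $k=\mathsf{rand}\,(\mathrm{length}(!u)-1)$, lets $y$ be the $k$-th element (from $0$) of $!u$, updates the map by $x\mapsto y$, and removes the $k$-th element from the list stored in $u$; in all cases it then returns the value the map assigns to $x$. -}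

module Defs where

open import Data.Bool using (Bool; true; false; T; if_then_else_; _∧_)
import Data.Bool.Properties as Bool
open import Data.Bool.Properties using (T-∧)
open import Data.Fin as Fin using (Fin; zero; suc; toℕ)
open import Data.Integer as ℤ using (ℤ; +_; -[1+_]; +[1+_])
import Data.Integer.Properties as ℤ
open import Data.List using (List; []; _∷_; map; foldr; length; allFin; upTo)
open import Data.List.Properties using (length-tabulate)
open import Data.List.Relation.Unary.All using (All; []; _∷_)
open import Data.Maybe using (Maybe; just; nothing; maybe′)
open import Data.Nat as ℕ using (ℕ; zero; suc)
import Data.Nat.Properties as ℕ
open import Data.Product using (Σ; ∃; _×_; _,_; proj₁; proj₂)
open import Data.Rational as ℚ using (ℚ; 0ℚ; 1ℚ)
import Data.Rational.Properties as ℚ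
open import Data.Rational.Unnormalised as ℚᵘ using (mkℚᵘ; *≡*)
import Data.Rational.Unnormalised.Properties as ℚᵘ
open import Data.Sum using (_⊎_; inj₁; inj₂)
import Data.Vec as Vec
open import Data.Vec using (Vec; []; _∷_)
open import Function using (case_of_)
open import Function.Bundles using (Equivalence)
open import Relation.Binary using (DecidableEquality)
open import Relation.Binary.PropositionalEquality
  using (_≡_; refl; sym; trans; cong; cong₂; subst)
open import Relation.Nullary using (Dec; yes; no; does)
open import Relation.Nullary.Decidable using (map′; T?)

------------------------------------------------------------------------
-- Subdistributions
--
-- All subdistributions below have finite support and rational weights; μ is
-- given by a list of weighted outcomes, μ(a) being the total weight of the
-- entries with outcome a.  Hence Σ_a μ(a)·f(a) is a sum over that list.

sumℚ : List ℚ → ℚ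
sumℚ = foldr ℚ._+_ 0ℚ

sumOver : {A : Set} → List (ℚ × A) → (A → ℚ) → ℚ
sumOver []             f = 0ℚ
sumOver ((p , a) ∷ xs) f = p ℚ.* f a ℚ.+ sumOver xs f

weights : {A : Set} → List (ℚ × A) → List ℚ
weights = map proj₁

record SubDist (A : Set) : Set where
  constructor subDist
  field
    outcomes : List (ℚ × A)
    nonNeg   : All (0ℚ ℚ.≤_) (weights outcomes)
    mass≤1   : sumℚ (weights outcomes) ℚ.≤ 1ℚ

open SubDist public

𝔼 : {A : Set} → SubDist A → (A → ℚ) → ℚ
𝔼 μ = sumOver (outcomes μ)

dzero : {A : Set} → SubDist A
dzero = subDist [] [] (ℚ.nonNegative⁻¹ 1ℚ)

dret : {A : Set} → A → SubDist A
dret a = subDist ((1ℚ , a) ∷ []) (ℚ.nonNegative⁻¹ 1ℚ ∷ []) ℚ.≤-refl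

weights-map : {A B : Set} (f : A → B) (xs : List (ℚ × A)) →
              weights (map (λ (p , a) → p , f a) xs) ≡ weights xs
weights-map f []       = refl
weights-map f (x ∷ xs) = cong (proj₁ x ∷_) (weights-map f xs)

dmap : {A B : Set} → (A → B) → SubDist A → SubDist B
dmap f (subDist xs nn m) = subDist
  (map (λ (p , a) → p , f a) xs)
  (subst (All (0ℚ ℚ.≤_)) (sym (weights-map f xs)) nn)
  (subst (λ ws → sumℚ ws ℚ.≤ 1ℚ) (sym (weights-map f xs)) m)

private
  /-suc : ∀ k d → (+ 1 ℚ./ suc d) ℚ.+ (+ k ℚ./ suc d) ≡ + suc k ℚ./ suc d
  /-suc k d = ℚ.toℚᵘ-injective (begin
    ℚ.toℚᵘ (ℚ.fromℚᵘ (mkℚᵘ (+ 1) d) ℚ.+ ℚ.fromℚᵘ (mkℚᵘ (+ k) d))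
      ≈⟨ ℚ.toℚᵘ-homo-+ (ℚ.fromℚᵘ (mkℚᵘ (+ 1) d)) (ℚ.fromℚᵘ (mkℚᵘ (+ k) d)) ⟩
    ℚ.toℚᵘ (ℚ.fromℚᵘ (mkℚᵘ (+ 1) d)) ℚᵘ.+ ℚ.toℚᵘ (ℚ.fromℚᵘ (mkℚᵘ (+ k) d))
      ≈⟨ ℚᵘ.+-cong (ℚ.toℚᵘ-fromℚᵘ (mkℚᵘ (+ 1) d)) (ℚ.toℚᵘ-fromℚᵘ (mkℚᵘ (+ k) d)) ⟩
    mkℚᵘ (+ 1) d ℚᵘ.+ mkℚᵘ (+ k) d
      ≈⟨ *≡* (trans (cong (ℤ._* + suc d) (sym (ℤ.*-distribʳ-+ (+ suc d) (+ 1) (+ k))))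
                    (trans (ℤ.*-assoc (+ suc k) (+ suc d) (+ suc d))
                           (cong (+ suc k ℤ.*_) (sym (ℤ.pos-* (suc d) (suc d)))))) ⟩
    mkℚᵘ (+ suc k) d
      ≈⟨ ℚ.toℚᵘ-fromℚᵘ (mkℚᵘ (+ suc k) d) ⟨
    ℚ.toℚᵘ (ℚ.fromℚᵘ (mkℚᵘ (+ suc k) d)) ∎)
    where open ℚᵘ.≃-Reasoning

  n/n≡1 : ∀ d → + suc d ℚ./ suc d ≡ 1ℚ
  n/n≡1 d = ℚ.fromℚᵘ-cong {mkℚᵘ (+ suc d) d} {mkℚᵘ (+ 1) 0}
              (*≡* (ℤ.*-comm (+ suc d) (+ 1)))

  equal-mass : {A : Set} (d : ℕ) (xs : List A) →
               sumℚ (weights (map (λ a → + 1 ℚ./ suc d , a) xs)) ≡ + length xs ℚ./ suc d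
  equal-mass d []       = sym (ℚ.0/n≡0 (suc d))
  equal-mass d (x ∷ xs) = trans (cong ((+ 1 ℚ./ suc d) ℚ.+_) (equal-mass d xs))
                                (/-suc (length xs) d)

  equal-nonNeg : {A : Set} (d : ℕ) (xs : List A) →
                 All (0ℚ ℚ.≤_) (weights (map (λ a → + 1 ℚ./ suc d , a) xs))
  equal-nonNeg d []       = []
  equal-nonNeg d (x ∷ xs) =
    ℚ.nonNegative⁻¹ (+ 1 ℚ./ suc d) {{ℚ.normalize-nonNeg 1 (suc d)}} ∷ equal-nonNeg d xs

uniform : (N : ℕ) → SubDist (Fin (suc N))
uniform N = subDist
  (map (λ i → + 1 ℚ./ suc N , i) (allFin (suc N)))
  (equal-nonNeg N (allFin (suc N)))
  (ℚ.≤-reflexive (trans (equal-mass N (allFin (suc N)))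
    (trans (cong (λ k → + k ℚ./ suc N) (length-tabulate {n = suc N} (λ i → i)))
           (n/n≡1 N))))

------------------------------------------------------------------------
-- Syntax

data BinOp : Set where
  plus minus times div mod : BinOp
  less leq equal           : BinOp

-- Expr n has its free variables in Fin n, so closed expressions are Expr 0.
-- Binders (index 0 first):  rec f x = e  binds x, f;  each branch of case
-- binds the payload.

mutual
  data Val : Set where
    unitᵛ : Val
    boolᵛ : Bool → Val
    intᵛ  : ℤ → Val
    locᵛ  : ℕ → Val
    lblᵛ  : ℕ → Val
    recᵛ  : Expr 2 → Val
    pairᵛ : Val → Val → Val
    inlᵛ  : Val → Val
    inrᵛ  : Val → Val

  data Expr (n : ℕ) : Set where
    val    : Val → Expr n
    var    : Fin n → Expr n
    rec    : Expr (2 ℕ.+ n) → Expr n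
    app    : Expr n → Expr n → Expr n
    binop  : BinOp → Expr n → Expr n → Expr n
    ite    : Expr n → Expr n → Expr n → Expr n
    pair   : Expr n → Expr n → Expr n
    fst    : Expr n → Expr n
    snd    : Expr n → Expr n
    inl    : Expr n → Expr n
    inr    : Expr n → Expr n
    case   : Expr n → Expr (1 ℕ.+ n) → Expr (1 ℕ.+ n) → Expr n
    ref    : Expr n → Expr n
    load   : Expr n → Expr n
    store  : Expr n → Expr n → Expr n
    rand   : Expr n → Expr n
    tape   : Expr n → Expr n
    randOn : Expr n → Expr n → Expr n

value? : ∀ {n} → Expr n → Maybe Val
value? (val v) = just v
value? _       = nothing

-- Simultaneous substitution of values (which are closed) and variables.

Sub : ℕ → ℕ → Set
Sub m n = Fin m → Val ⊎ Fin n

lift : ∀ {m n} → Sub m n → Sub (suc m) (suc n)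
lift s zero    = inj₂ zero
lift s (suc i) with s i
... | inj₁ v = inj₁ v
... | inj₂ j = inj₂ (suc j)

atom : ∀ {n} → Val ⊎ Fin n → Expr n
atom (inj₁ v) = val v
atom (inj₂ i) = var i

sub : ∀ {m n} → Sub m n → Expr m → Expr n
sub s (val v)         = val v
sub s (var i)         = atom (s i)
sub s (rec e)         = rec (sub (lift (lift s)) e)
sub s (app e₁ e₂)     = app (sub s e₁) (sub s e₂)
sub s (binop o e₁ e₂) = binop o (sub s e₁) (sub s e₂)
sub s (ite e e₁ e₂)   = ite (sub s e) (sub s e₁) (sub s e₂)
sub s (pair e₁ e₂)    = pair (sub s e₁) (sub s e₂)
sub s (fst e)         = fst (sub s e)
sub s (snd e)         = snd (sub s e)
sub s (inl e)         = inl (sub s e)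
sub s (inr e)         = inr (sub s e)
sub s (case e e₁ e₂)  = case (sub s e) (sub (lift s) e₁) (sub (lift s) e₂)
sub s (ref e)         = ref (sub s e)
sub s (load e)        = load (sub s e)
sub s (store e₁ e₂)   = store (sub s e₁) (sub s e₂)
sub s (rand e)        = rand (sub s e)
sub s (tape e)        = tape (sub s e)
sub s (randOn e₁ e₂)  = randOn (sub s e₁) (sub s e₂)

inst₁ : Val → Sub 1 0
inst₁ v zero = inj₁ v

inst₂ : Val → Val → Sub 2 0
inst₂ v w zero       = inj₁ v
inst₂ v w (suc zero) = inj₁ w

weaken : ∀ {n} → Expr n → Expr (suc n)
weaken = sub (λ i → inj₂ (suc i))

skip₁ : ∀ {n} → Sub (1 ℕ.+ n) (2 ℕ.+ n)
skip₁ zero    = inj₂ zero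
skip₁ (suc i) = inj₂ (suc (suc i))

lam : ∀ {n} → Expr (suc n) → Expr n
lam e = rec (sub skip₁ e)

let′ : ∀ {n} → Expr n → Expr (suc n) → Expr n
let′ e₁ e₂ = app (lam e₂) e₁

seq : ∀ {n} → Expr n → Expr n → Expr n
seq e₁ e₂ = let′ e₁ (weaken e₂)

int : ∀ {n} → ℤ → Expr n
int z = val (intᵛ z)

none : ∀ {n} → Expr n
none = inl (val unitᵛ)

some : ∀ {n} → Expr n → Expr n
some = inr

-- The forms for universal, existential and recursive types are the usual
-- type-erased ones, so that they need no values beyond those of Val:
-- Λ.e = λ_.e,  e⟨⟩ = e (),  unpack is let,  unfold is a β-step, and pack and
-- fold are silent.

tlam : ∀ {n} → Expr n → Expr n
tlam e = lam (weaken e)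

tlamᵛ : Expr 0 → Val
tlamᵛ e = recᵛ (sub skip₁ (weaken e))

tapp : ∀ {n} → Expr n → Expr n
tapp e = app e (val unitᵛ)

pack : ∀ {n} → Expr n → Expr n
pack e = e

unpack : ∀ {n} → Expr n → Expr (suc n) → Expr n
unpack = let′

fold : ∀ {n} → Expr n → Expr n
fold e = e

unfold : ∀ {n} → Expr n → Expr n
unfold e = app (lam (var zero)) e

------------------------------------------------------------------------
-- Decidable equality of values (needed to evaluate exec(e,σ) at a value)

binOpCode : BinOp → ℕ
binOpCode plus  = 0
binOpCode minus = 1
binOpCode times = 2
binOpCode div   = 3
binOpCode mod   = 4
binOpCode less  = 5
binOpCode leq   = 6
binOpCode equal = 7

binOpDecode : ℕ → BinOp
binOpDecode 0 = plus
binOpDecode 1 = minus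
binOpDecode 2 = times
binOpDecode 3 = div
binOpDecode 4 = mod
binOpDecode 5 = less
binOpDecode 6 = leq
binOpDecode _ = equal

binOpDecode-code : ∀ o → binOpDecode (binOpCode o) ≡ o
binOpDecode-code plus  = refl
binOpDecode-code minus = refl
binOpDecode-code times = refl
binOpDecode-code div   = refl
binOpDecode-code mod   = refl
binOpDecode-code less  = refl
binOpDecode-code leq   = refl
binOpDecode-code equal = refl

_≟ᵒ_ : DecidableEquality BinOp
o ≟ᵒ o′ = map′ (λ eq → trans (sym (binOpDecode-code o))
                         (trans (cong binOpDecode eq) (binOpDecode-code o′)))
               (cong binOpCode) (binOpCode o ℕ.≟ binOpCode o′)

mutual
  eqᵛ : Val → Val → Bool
  eqᵛ unitᵛ       unitᵛ         = true
  eqᵛ (boolᵛ b)   (boolᵛ b′)    = does (b Bool.≟ b′)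
  eqᵛ (intᵛ z)    (intᵛ z′)     = does (z ℤ.≟ z′)
  eqᵛ (locᵛ l)    (locᵛ l′)     = does (l ℕ.≟ l′)
  eqᵛ (lblᵛ l)    (lblᵛ l′)     = does (l ℕ.≟ l′)
  eqᵛ (recᵛ e)    (recᵛ e′)     = eqᵉ e e′
  eqᵛ (pairᵛ v w) (pairᵛ v′ w′) = eqᵛ v v′ ∧ eqᵛ w w′
  eqᵛ (inlᵛ v)    (inlᵛ v′)     = eqᵛ v v′
  eqᵛ (inrᵛ v)    (inrᵛ v′)     = eqᵛ v v′
  eqᵛ _           _             = false

  eqᵉ : ∀ {n} → Expr n → Expr n → Bool
  eqᵉ (val v)       (val v′)        = eqᵛ v v′
  eqᵉ (var i)       (var j)         = does (i Fin.≟ j)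
  eqᵉ (rec a)       (rec a′)        = eqᵉ a a′
  eqᵉ (app a b)     (app a′ b′)     = eqᵉ a a′ ∧ eqᵉ b b′
  eqᵉ (binop o a b) (binop o′ a′ b′) = does (o ≟ᵒ o′) ∧ eqᵉ a a′ ∧ eqᵉ b b′
  eqᵉ (ite a b c)   (ite a′ b′ c′)  = eqᵉ a a′ ∧ eqᵉ b b′ ∧ eqᵉ c c′
  eqᵉ (pair a b)    (pair a′ b′)    = eqᵉ a a′ ∧ eqᵉ b b′
  eqᵉ (fst a)       (fst a′)        = eqᵉ a a′
  eqᵉ (snd a)       (snd a′)        = eqᵉ a a′
  eqᵉ (inl a)       (inl a′)        = eqᵉ a a′
  eqᵉ (inr a)       (inr a′)        = eqᵉ a a′
  eqᵉ (case a b c)  (case a′ b′ c′) = eqᵉ a a′ ∧ eqᵉ b b′ ∧ eqᵉ c c′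
  eqᵉ (ref a)       (ref a′)        = eqᵉ a a′
  eqᵉ (load a)      (load a′)       = eqᵉ a a′
  eqᵉ (store a b)   (store a′ b′)   = eqᵉ a a′ ∧ eqᵉ b b′
  eqᵉ (rand a)      (rand a′)       = eqᵉ a a′
  eqᵉ (tape a)      (tape a′)       = eqᵉ a a′
  eqᵉ (randOn a b)  (randOn a′ b′)  = eqᵉ a a′ ∧ eqᵉ b b′
  eqᵉ _             _               = false

private
  split : ∀ {x y} → T (x ∧ y) → T x × T y
  split = Equivalence.to T-∧

  join : ∀ {x y} → T x → T y → T (x ∧ y)
  join p q = Equivalence.from T-∧ (p , q)

  holds : ∀ {A : Set} (d : Dec A) → T (does d) → A
  holds (yes a) _ = a

  does-refl : ∀ {A : Set} (_≟_ : DecidableEquality A) (a : A) → T (does (a ≟ a))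
  does-refl _≟_ a with a ≟ a
  ... | yes _  = _
  ... | no a≢a = a≢a refl

mutual
  eqᵛ-sound : ∀ v w → T (eqᵛ v w) → v ≡ w
  eqᵛ-sound unitᵛ       unitᵛ         p = refl
  eqᵛ-sound (boolᵛ b)   (boolᵛ b′)    p = cong boolᵛ (holds (b Bool.≟ b′) p)
  eqᵛ-sound (intᵛ z)    (intᵛ z′)     p = cong intᵛ (holds (z ℤ.≟ z′) p)
  eqᵛ-sound (locᵛ l)    (locᵛ l′)     p = cong locᵛ (holds (l ℕ.≟ l′) p)
  eqᵛ-sound (lblᵛ l)    (lblᵛ l′)     p = cong lblᵛ (holds (l ℕ.≟ l′) p)
  eqᵛ-sound (recᵛ e)    (recᵛ e′)     p = cong recᵛ (eqᵉ-sound e e′ p)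
  eqᵛ-sound (pairᵛ v w) (pairᵛ v′ w′) p = let q , r = split p in
    cong₂ pairᵛ (eqᵛ-sound v v′ q) (eqᵛ-sound w w′ r)
  eqᵛ-sound (inlᵛ v)    (inlᵛ v′)     p = cong inlᵛ (eqᵛ-sound v v′ p)
  eqᵛ-sound (inrᵛ v)    (inrᵛ v′)     p = cong inrᵛ (eqᵛ-sound v v′ p)

  private
    two : ∀ {k l m} {f : Expr k → Expr l → Expr m} a b a′ b′ →
          T (eqᵉ a a′ ∧ eqᵉ b b′) → f a b ≡ f a′ b′
    two {f = f} a b a′ b′ p = let q , r = split p in
      cong₂ f (eqᵉ-sound a a′ q) (eqᵉ-sound b b′ r)

  eqᵉ-sound : ∀ {n} (a b : Expr n) → T (eqᵉ a b) → a ≡ b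
  eqᵉ-sound (val v)       (val v′)        p = cong val (eqᵛ-sound v v′ p)
  eqᵉ-sound (var i)       (var j)         p = cong var (holds (i Fin.≟ j) p)
  eqᵉ-sound (rec a)       (rec a′)        p = cong rec (eqᵉ-sound a a′ p)
  eqᵉ-sound (app a b)     (app a′ b′)     p = two a b a′ b′ p
  eqᵉ-sound (binop o a b) (binop o′ a′ b′) p
    with q , r ← split {does (o ≟ᵒ o′)} p
    rewrite holds (o ≟ᵒ o′) q = two a b a′ b′ r
  eqᵉ-sound (ite a b c)   (ite a′ b′ c′)  p
    with q , r ← split p rewrite eqᵉ-sound a a′ q = two b c b′ c′ r
  eqᵉ-sound (pair a b)    (pair a′ b′)    p = two a b a′ b′ p
  eqᵉ-sound (fst a)       (fst a′)        p = cong fst (eqᵉ-sound a a′ p)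
  eqᵉ-sound (snd a)       (snd a′)        p = cong snd (eqᵉ-sound a a′ p)
  eqᵉ-sound (inl a)       (inl a′)        p = cong inl (eqᵉ-sound a a′ p)
  eqᵉ-sound (inr a)       (inr a′)        p = cong inr (eqᵉ-sound a a′ p)
  eqᵉ-sound (case a b c)  (case a′ b′ c′) p
    with q , r ← split p rewrite eqᵉ-sound a a′ q = two b c b′ c′ r
  eqᵉ-sound (ref a)       (ref a′)        p = cong ref (eqᵉ-sound a a′ p)
  eqᵉ-sound (load a)      (load a′)       p = cong load (eqᵉ-sound a a′ p)
  eqᵉ-sound (store a b)   (store a′ b′)   p = two a b a′ b′ p
  eqᵉ-sound (rand a)      (rand a′)       p = cong rand (eqᵉ-sound a a′ p)
  eqᵉ-sound (tape a)      (tape a′)       p = cong tape (eqᵉ-sound a a′ p)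
  eqᵉ-sound (randOn a b)  (randOn a′ b′)  p = two a b a′ b′ p

mutual
  eqᵛ-refl : ∀ v → T (eqᵛ v v)
  eqᵛ-refl unitᵛ       = _
  eqᵛ-refl (boolᵛ b)   = does-refl Bool._≟_ b
  eqᵛ-refl (intᵛ z)    = does-refl ℤ._≟_ z
  eqᵛ-refl (locᵛ l)    = does-refl ℕ._≟_ l
  eqᵛ-refl (lblᵛ l)    = does-refl ℕ._≟_ l
  eqᵛ-refl (recᵛ e)    = eqᵉ-refl e
  eqᵛ-refl (pairᵛ v w) = join (eqᵛ-refl v) (eqᵛ-refl w)
  eqᵛ-refl (inlᵛ v)    = eqᵛ-refl v
  eqᵛ-refl (inrᵛ v)    = eqᵛ-refl v

  eqᵉ-refl : ∀ {n} (e : Expr n) → T (eqᵉ e e)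
  eqᵉ-refl (val v)       = eqᵛ-refl v
  eqᵉ-refl (var i)       = does-refl Fin._≟_ i
  eqᵉ-refl (rec a)       = eqᵉ-refl a
  eqᵉ-refl (app a b)     = join (eqᵉ-refl a) (eqᵉ-refl b)
  eqᵉ-refl (binop o a b) =
    join {does (o ≟ᵒ o)} (does-refl _≟ᵒ_ o) (join (eqᵉ-refl a) (eqᵉ-refl b))
  eqᵉ-refl (ite a b c)   = join (eqᵉ-refl a) (join (eqᵉ-refl b) (eqᵉ-refl c))
  eqᵉ-refl (pair a b)    = join (eqᵉ-refl a) (eqᵉ-refl b)
  eqᵉ-refl (fst a)       = eqᵉ-refl a
  eqᵉ-refl (snd a)       = eqᵉ-refl a
  eqᵉ-refl (inl a)       = eqᵉ-refl a
  eqᵉ-refl (inr a)       = eqᵉ-refl a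
  eqᵉ-refl (case a b c)  = join (eqᵉ-refl a) (join (eqᵉ-refl b) (eqᵉ-refl c))
  eqᵉ-refl (ref a)       = eqᵉ-refl a
  eqᵉ-refl (load a)      = eqᵉ-refl a
  eqᵉ-refl (store a b)   = join (eqᵉ-refl a) (eqᵉ-refl b)
  eqᵉ-refl (rand a)      = eqᵉ-refl a
  eqᵉ-refl (tape a)      = eqᵉ-refl a
  eqᵉ-refl (randOn a b)  = join (eqᵉ-refl a) (eqᵉ-refl b)

_≟ᵛ_ : DecidableEquality Val
v ≟ᵛ w = map′ (eqᵛ-sound v w) (λ { refl → eqᵛ-refl v }) (T? (eqᵛ v w))

------------------------------------------------------------------------
-- States
--
-- A finite partial map is an association list in which the first entry for a
-- key is the one that counts.

Store : Set → Set
Store A = List (ℕ × A)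

lookup : {A : Set} → Store A → ℕ → Maybe A
lookup []            l = nothing
lookup ((k , a) ∷ s) l = if does (k ℕ.≟ l) then just a else lookup s l

insert : {A : Set} → ℕ → A → Store A → Store A
insert l a s = (l , a) ∷ s

fresh : {A : Set} → Store A → ℕ
fresh []            = 0
fresh ((k , _) ∷ s) = suc k ℕ.⊔ fresh s

Tape : Set
Tape = Σ ℕ λ N → List (Fin (suc N))

record State : Set where
  constructor state
  field
    heap  : Store Val
    tapes : Store Tape

open State public

Cfg : Set
Cfg = Expr 0 × State

------------------------------------------------------------------------
-- Semantics

-- Division and remainder are Euclidean; a zero divisor is stuck.
intOp : BinOp → ℤ → ℤ → Maybe Val
intOp plus  a b            = just (intᵛ (a ℤ.+ b))
intOp minus a b            = just (intᵛ (a ℤ.- b))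
intOp times a b            = just (intᵛ (a ℤ.* b))
intOp div   a (+ 0)        = nothing
intOp div   a b@(+[1+ _ ]) = just (intᵛ (a ℤ./ b))
intOp div   a b@(-[1+ _ ]) = just (intᵛ (a ℤ./ b))
intOp mod   a (+ 0)        = nothing
intOp mod   a b@(+[1+ _ ]) = just (intᵛ (+ (a ℤ.% b)))
intOp mod   a b@(-[1+ _ ]) = just (intᵛ (+ (a ℤ.% b)))
intOp less  a b            = just (boolᵛ (does (a ℤ.<? b)))
intOp leq   a b            = just (boolᵛ (does (a ℤ.≤? b)))
intOp equal a b            = just (boolᵛ (does (a ℤ.≟ b)))

binOp : BinOp → Val → Val → Maybe Val
binOp o     (intᵛ a)  (intᵛ b)   = intOp o a b
binOp equal unitᵛ     unitᵛ      = just (boolᵛ true)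
binOp equal (boolᵛ b) (boolᵛ b′) = just (boolᵛ (does (b Bool.≟ b′)))
binOp equal (locᵛ l)  (locᵛ l′)  = just (boolᵛ (does (l ℕ.≟ l′)))
binOp _     _         _          = nothing

-- Negative bounds are treated as 0.
bound : ℤ → ℕ
bound (+ n)    = n
bound -[1+ _ ] = 0

ret : Expr 0 → State → SubDist Cfg
ret e σ = dret (e , σ)

stuckD : SubDist Cfg
stuckD = dzero

-- Head reductions, given the values of the evaluated subexpressions.

appH : Val → Val → State → SubDist Cfg
appH (recᵛ e) v σ = ret (sub (inst₂ v (recᵛ e)) e) σ
appH _        _ σ = stuckD

binopH : BinOp → Val → Val → State → SubDist Cfg
binopH o v w σ = maybe′ (λ u → ret (val u) σ) stuckD (binOp o v w)

iteH : Val → Expr 0 → Expr 0 → State → SubDist Cfg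
iteH (boolᵛ b) e₁ e₂ σ = ret (if b then e₁ else e₂) σ
iteH _         _  _  σ = stuckD

fstH : Val → State → SubDist Cfg
fstH (pairᵛ v w) σ = ret (val v) σ
fstH _           σ = stuckD

sndH : Val → State → SubDist Cfg
sndH (pairᵛ v w) σ = ret (val w) σ
sndH _           σ = stuckD

caseH : Val → Expr 1 → Expr 1 → State → SubDist Cfg
caseH (inlᵛ v) e₁ e₂ σ = ret (sub (inst₁ v) e₁) σ
caseH (inrᵛ v) e₁ e₂ σ = ret (sub (inst₁ v) e₂) σ
caseH _        _  _  σ = stuckD

refH : Val → State → SubDist Cfg
refH v (state h t) = ret (val (locᵛ (fresh h))) (state (insert (fresh h) v h) t)

loadH : Val → State → SubDist Cfg
loadH (locᵛ l) σ = maybe′ (λ v → ret (val v) σ) stuckD (lookup (heap σ) l)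
loadH _        σ = stuckD

storeH : Val → Val → State → SubDist Cfg
storeH (locᵛ l) v (state h t) =
  maybe′ (λ _ → ret (val unitᵛ) (state (insert l v h) t)) stuckD (lookup h l)
storeH _        _ _           = stuckD

sample : ℕ → State → SubDist Cfg
sample N σ = dmap (λ i → int (+ toℕ i) , σ) (uniform N)

randH : Val → State → SubDist Cfg
randH (intᵛ z) σ = sample (bound z) σ
randH _        σ = stuckD

tapeH : Val → State → SubDist Cfg
tapeH (intᵛ z) (state h t) =
  ret (val (lblᵛ (fresh t))) (state h (insert (fresh t) (bound z , []) t))
tapeH _        _           = stuckD

-- A tape whose bound differs from the requested one is stuck.
readTape : ℕ → ℕ → Maybe Tape → State → SubDist Cfg
readTape N ι nothing            σ           = stuckD
readTape N ι (just (M , ns))    (state h t) =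
  if does (M ℕ.≟ N)
  then (case ns of λ where
    []       → sample N (state h t)
    (n ∷ ns) → ret (int (+ toℕ n)) (state h (insert ι (M , ns) t)))
  else stuckD

randOnH : Val → Val → State → SubDist Cfg
randOnH (intᵛ z) (lblᵛ ι) σ = readTape (bound z) ι (lookup (tapes σ) ι) σ
randOnH _        _        _ = stuckD

-- eval e K d k: if e is a value, continue with k; otherwise reduce under the
-- evaluation context K, where d is the step distribution of e.
eval : Expr 0 → (Expr 0 → Expr 0) → SubDist Cfg → (Val → SubDist Cfg) → SubDist Cfg
eval e K d k = maybe′ k (dmap (λ (e′ , σ′) → K e′ , σ′) d) (value? e)

step : Expr 0 → State → SubDist Cfg
step (val v)         σ = stuckD
step (rec e)         σ = ret (val (recᵛ e)) σ
step (app e₁ e₂)     σ = eval e₂ (app e₁) (step e₂ σ) λ w →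
                         eval e₁ (λ e → app e (val w)) (step e₁ σ) λ v →
                         appH v w σ
step (binop o e₁ e₂) σ = eval e₂ (binop o e₁) (step e₂ σ) λ w →
                         eval e₁ (λ e → binop o e (val w)) (step e₁ σ) λ v →
                         binopH o v w σ
step (ite e e₁ e₂)   σ = eval e (λ e → ite e e₁ e₂) (step e σ) λ v → iteH v e₁ e₂ σ
step (pair e₁ e₂)    σ = eval e₂ (pair e₁) (step e₂ σ) λ w →
                         eval e₁ (λ e → pair e (val w)) (step e₁ σ) λ v →
                         ret (val (pairᵛ v w)) σ
step (fst e)         σ = eval e fst (step e σ) λ v → fstH v σ
step (snd e)         σ = eval e snd (step e σ) λ v → sndH v σ
step (inl e)         σ = eval e inl (step e σ) λ v → ret (val (inlᵛ v)) σ
step (inr e)         σ = eval e inr (step e σ) λ v → ret (val (inrᵛ v)) σ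
step (case e e₁ e₂)  σ = eval e (λ e → case e e₁ e₂) (step e σ) λ v → caseH v e₁ e₂ σ
step (ref e)         σ = eval e ref (step e σ) λ v → refH v σ
step (load e)        σ = eval e load (step e σ) λ v → loadH v σ
step (store e₁ e₂)   σ = eval e₂ (store e₁) (step e₂ σ) λ w →
                         eval e₁ (λ e → store e (val w)) (step e₁ σ) λ v →
                         storeH v w σ
step (rand e)        σ = eval e rand (step e σ) λ v → randH v σ
step (tape e)        σ = eval e tape (step e σ) λ v → tapeH v σ
step (randOn e₁ e₂)  σ = eval e₂ (randOn e₁) (step e₂ σ) λ w →
                         eval e₁ (λ e → randOn e (val w)) (step e₁ σ) λ v →
                         randOnH v w σ

pointMass : Val → Val → ℚ
pointMass w v = if does (w ≟ᵛ v) then 1ℚ else 0ℚ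

execₙ : ℕ → Cfg → Val → ℚ
execₙ zero    (e , σ) v = maybe′ (λ w → pointMass w v) 0ℚ (value? e)
execₙ (suc m) (e , σ) v =
  maybe′ (λ w → pointMass w v) (𝔼 (step e σ) (λ ρ → execₙ m ρ v)) (value? e)

private
  sumOver-mono : {A : Set} {f g : A → ℚ} → (∀ a → f a ℚ.≤ g a) →
                 (xs : List (ℚ × A)) → All (0ℚ ℚ.≤_) (weights xs) →
                 sumOver xs f ℚ.≤ sumOver xs g
  sumOver-mono f≤g []             []         = ℚ.≤-refl
  sumOver-mono f≤g ((p , a) ∷ xs) (0≤p ∷ nn) =
    ℚ.+-mono-≤ (ℚ.*-monoˡ-≤-nonNeg p {{ℚ.nonNegative 0≤p}} (f≤g a)) (sumOver-mono f≤g xs nn)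

  sumOver-nonNeg : {A : Set} {f : A → ℚ} → (∀ a → 0ℚ ℚ.≤ f a) →
                   (xs : List (ℚ × A)) → All (0ℚ ℚ.≤_) (weights xs) →
                   0ℚ ℚ.≤ sumOver xs f
  sumOver-nonNeg 0≤f []             []         = ℚ.≤-refl
  sumOver-nonNeg {f = f} 0≤f ((p , a) ∷ xs) (0≤p ∷ nn) =
    ℚ.+-mono-≤ (subst (ℚ._≤ p ℚ.* f a) (ℚ.*-zeroʳ p)
                 (ℚ.*-monoˡ-≤-nonNeg p {{ℚ.nonNegative 0≤p}} (0≤f a)))
               (sumOver-nonNeg 0≤f xs nn)

pointMass-nonNeg : ∀ w v → 0ℚ ℚ.≤ pointMass w v
pointMass-nonNeg w v with does (w ≟ᵛ v)
... | true  = ℚ.nonNegative⁻¹ 1ℚ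
... | false = ℚ.≤-refl

execₙ-nonNeg : ∀ n ρ v → 0ℚ ℚ.≤ execₙ n ρ v
execₙ-nonNeg zero    (e , σ) v with value? e
... | just w  = pointMass-nonNeg w v
... | nothing = ℚ.≤-refl
execₙ-nonNeg (suc n) (e , σ) v with value? e
... | just w  = pointMass-nonNeg w v
... | nothing = sumOver-nonNeg (λ ρ → execₙ-nonNeg n ρ v)
                  (outcomes (step e σ)) (nonNeg (step e σ))

execₙ-mono : ∀ n ρ v → execₙ n ρ v ℚ.≤ execₙ (suc n) ρ v
execₙ-mono zero    (e , σ) v with value? e
... | just w  = ℚ.≤-refl
... | nothing = sumOver-nonNeg (λ ρ → execₙ-nonNeg 0 ρ v)
                  (outcomes (step e σ)) (nonNeg (step e σ))
execₙ-mono (suc n) (e , σ) v with value? e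
... | just w  = ℚ.≤-refl
... | nothing = sumOver-mono (λ ρ → execₙ-mono n ρ v)
                  (outcomes (step e σ)) (nonNeg (step e σ))

------------------------------------------------------------------------
-- Limits of nondecreasing rational sequences
--
-- execₙ is nondecreasing in n, but its limit is not computable in general, so
-- it is taken in the lower reals: a real is represented by its lower Dedekind
-- cut, the set of rationals strictly below it.

record LowerReal : Set₁ where
  field
    Below     : ℚ → Set
    inhabited : ∃ Below
    closed    : ∀ {p q} → p ℚ.< q → Below q → Below p
    rounded   : ∀ {p} → Below p → ∃ λ q → p ℚ.< q × Below q

open LowerReal public

infix 4 _≤ᴸ_

_≤ᴸ_ : LowerReal → LowerReal → Set
x ≤ᴸ y = ∀ q → Below x q → Below y q

lim : (a : ℕ → ℚ) → (∀ n → a n ℚ.≤ a (suc n)) → LowerReal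
lim a mono = record
  { Below     = λ q → ∃ λ n → q ℚ.< a n
  ; inhabited = a 0 ℚ.- 1ℚ , 0 ,
      subst (a 0 ℚ.- 1ℚ ℚ.<_) (ℚ.+-identityʳ (a 0))
        (ℚ.+-monoʳ-< (a 0) (ℚ.negative⁻¹ (ℚ.- 1ℚ)))
  ; closed    = λ p<q (n , q<a) → n , ℚ.<-trans p<q q<a
  ; rounded   = λ (n , p<a) →
      let q , p<q , q<a = ℚ.<-dense p<a in q , p<q , n , q<a
  }

private
  shift : ∀ p r → (p ℚ.+ r) ℚ.- r ≡ p
  shift p r = trans (ℚ.+-assoc p r (ℚ.- r))
    (trans (cong (p ℚ.+_) (ℚ.+-inverseʳ r)) (ℚ.+-identityʳ p))

  unshift : ∀ p r → (p ℚ.- r) ℚ.+ r ≡ p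
  unshift p r = trans (ℚ.+-assoc p (ℚ.- r) r)
    (trans (cong (p ℚ.+_) (ℚ.+-inverseˡ r)) (ℚ.+-identityʳ p))

infixl 6 _+ᴸ_

_+ᴸ_ : LowerReal → ℚ → LowerReal
x +ᴸ r = record
  { Below     = λ q → Below x (q ℚ.- r)
  ; inhabited = let q , b = inhabited x in
      q ℚ.+ r , subst (Below x) (sym (shift q r)) b
  ; closed    = λ p<q → closed x (ℚ.+-monoˡ-< (ℚ.- r) p<q)
  ; rounded   = λ {p} b → let q , p<q , c = rounded x b in
      q ℚ.+ r ,
      subst (ℚ._< q ℚ.+ r) (unshift p r) (ℚ.+-monoˡ-< r p<q) ,
      subst (Below x) (sym (shift q r)) c
  }

-- Lower reals have no subtraction; |x − y| ≤ r means x ≤ y + r and y ≤ x + r.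
∣_−_∣≤_ : LowerReal → LowerReal → ℚ → Set
∣ x − y ∣≤ r = (x ≤ᴸ y +ᴸ r) × (y ≤ᴸ x +ᴸ r)

exec : Expr 0 → State → Val → LowerReal
exec e σ v = lim (λ n → execₙ n (e , σ) v) (λ n → execₙ-mono n (e , σ) v)

------------------------------------------------------------------------
-- Types

infixr 7 _⇒_
infixr 8 _⊕_
infixr 9 _⊗_

-- Ty n has its free type variables in Fin n.
data Ty (n : ℕ) : Set where
  tvar              : Fin n → Ty n
  unitᵗ boolᵗ natᵗ  : Ty n
  intᵗ tapeᵗ        : Ty n
  _⊗_ _⊕_ _⇒_       : Ty n → Ty n → Ty n
  allᵗ exᵗ muᵗ      : Ty (suc n) → Ty n
  refᵗ              : Ty n → Ty n

option : ∀ {n} → Ty n → Ty n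
option τ = unitᵗ ⊕ τ

liftᵣ : ∀ {m n} → (Fin m → Fin n) → Fin (suc m) → Fin (suc n)
liftᵣ ρ zero    = zero
liftᵣ ρ (suc i) = suc (ρ i)

renᵗ : ∀ {m n} → (Fin m → Fin n) → Ty m → Ty n
renᵗ ρ (tvar i) = tvar (ρ i)
renᵗ ρ unitᵗ    = unitᵗ
renᵗ ρ boolᵗ    = boolᵗ
renᵗ ρ natᵗ     = natᵗ
renᵗ ρ intᵗ     = intᵗ
renᵗ ρ (τ ⊗ τ′) = renᵗ ρ τ ⊗ renᵗ ρ τ′
renᵗ ρ (τ ⊕ τ′) = renᵗ ρ τ ⊕ renᵗ ρ τ′
renᵗ ρ (τ ⇒ τ′) = renᵗ ρ τ ⇒ renᵗ ρ τ′
renᵗ ρ (allᵗ τ) = allᵗ (renᵗ (liftᵣ ρ) τ)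
renᵗ ρ (exᵗ τ)  = exᵗ (renᵗ (liftᵣ ρ) τ)
renᵗ ρ (muᵗ τ)  = muᵗ (renᵗ (liftᵣ ρ) τ)
renᵗ ρ (refᵗ τ) = refᵗ (renᵗ ρ τ)
renᵗ ρ tapeᵗ    = tapeᵗ

wkᵗ : ∀ {n} → Ty n → Ty (suc n)
wkᵗ = renᵗ suc

liftₛ : ∀ {m n} → (Fin m → Ty n) → Fin (suc m) → Ty (suc n)
liftₛ s zero    = tvar zero
liftₛ s (suc i) = wkᵗ (s i)

subᵗ : ∀ {m n} → (Fin m → Ty n) → Ty m → Ty n
subᵗ s (tvar i) = s i
subᵗ s unitᵗ    = unitᵗ
subᵗ s boolᵗ    = boolᵗ
subᵗ s natᵗ     = natᵗ
subᵗ s intᵗ     = intᵗ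
subᵗ s (τ ⊗ τ′) = subᵗ s τ ⊗ subᵗ s τ′
subᵗ s (τ ⊕ τ′) = subᵗ s τ ⊕ subᵗ s τ′
subᵗ s (τ ⇒ τ′) = subᵗ s τ ⇒ subᵗ s τ′
subᵗ s (allᵗ τ) = allᵗ (subᵗ (liftₛ s) τ)
subᵗ s (exᵗ τ)  = exᵗ (subᵗ (liftₛ s) τ)
subᵗ s (muᵗ τ)  = muᵗ (subᵗ (liftₛ s) τ)
subᵗ s (refᵗ τ) = refᵗ (subᵗ s τ)
subᵗ s tapeᵗ    = tapeᵗ

inst₁ᵗ : ∀ {n} → Ty n → Fin (suc n) → Ty n
inst₁ᵗ τ zero    = τ
inst₁ᵗ τ (suc i) = tvar i

_[_]ᵗ : ∀ {n} → Ty (suc n) → Ty n → Ty n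
τ [ τ′ ]ᵗ = subᵗ (inst₁ᵗ τ′) τ

------------------------------------------------------------------------
-- Typing

data Arith : BinOp → Set where
  plus  : Arith plus
  minus : Arith minus
  times : Arith times
  div   : Arith div
  mod   : Arith mod

-- the arithmetic operations under which ℕ is closed
data NatArith : BinOp → Set where
  plus  : NatArith plus
  times : NatArith times
  div   : NatArith div
  mod   : NatArith mod

data Compare : BinOp → Set where
  less  : Compare less
  leq   : Compare leq

-- the types whose values can be tested for equality
data EqTy {Δ : ℕ} : Ty Δ → Set where
  unitᵗ : EqTy unitᵗ
  boolᵗ : EqTy boolᵗ
  intᵗ  : EqTy intᵗ
  refᵗ  : ∀ τ → EqTy (refᵗ τ)

Ctx : ℕ → ℕ → Set
Ctx Δ n = Vec (Ty Δ) n

infix 3 _⊢_∶_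

-- There is no rule for locᵛ or lblᵛ.
data _⊢_∶_ {Δ n : ℕ} (Γ : Ctx Δ n) : Expr n → Ty Δ → Set where
  ⊢var    : ∀ i → Γ ⊢ var i ∶ Vec.lookup Γ i

  ⊢unit   : Γ ⊢ val unitᵛ ∶ unitᵗ
  ⊢bool   : ∀ b → Γ ⊢ val (boolᵛ b) ∶ boolᵗ
  ⊢nat    : ∀ k → Γ ⊢ val (intᵛ (+ k)) ∶ natᵗ
  ⊢int    : ∀ z → Γ ⊢ val (intᵛ z) ∶ intᵗ
  ⊢nat≤   : ∀ {e} → Γ ⊢ e ∶ natᵗ → Γ ⊢ e ∶ intᵗ

  ⊢natOp  : ∀ {o e₁ e₂} → NatArith o → Γ ⊢ e₁ ∶ natᵗ → Γ ⊢ e₂ ∶ natᵗ →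
            Γ ⊢ binop o e₁ e₂ ∶ natᵗ
  ⊢intOp  : ∀ {o e₁ e₂} → Arith o → Γ ⊢ e₁ ∶ intᵗ → Γ ⊢ e₂ ∶ intᵗ →
            Γ ⊢ binop o e₁ e₂ ∶ intᵗ
  ⊢cmp    : ∀ {o e₁ e₂} → Compare o → Γ ⊢ e₁ ∶ intᵗ → Γ ⊢ e₂ ∶ intᵗ →
            Γ ⊢ binop o e₁ e₂ ∶ boolᵗ
  ⊢equal  : ∀ {τ e₁ e₂} → EqTy τ → Γ ⊢ e₁ ∶ τ → Γ ⊢ e₂ ∶ τ →
            Γ ⊢ binop equal e₁ e₂ ∶ boolᵗ
  ⊢ite    : ∀ {τ e e₁ e₂} → Γ ⊢ e ∶ boolᵗ → Γ ⊢ e₁ ∶ τ → Γ ⊢ e₂ ∶ τ →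
            Γ ⊢ ite e e₁ e₂ ∶ τ

  ⊢rec    : ∀ {τ τ′ e} → (τ ∷ (τ ⇒ τ′) ∷ Γ) ⊢ e ∶ τ′ → Γ ⊢ rec e ∶ τ ⇒ τ′
  ⊢recᵛ   : ∀ {τ τ′ e} → (τ ∷ (τ ⇒ τ′) ∷ []) ⊢ e ∶ τ′ → Γ ⊢ val (recᵛ e) ∶ τ ⇒ τ′
  ⊢app    : ∀ {τ τ′ e₁ e₂} → Γ ⊢ e₁ ∶ τ ⇒ τ′ → Γ ⊢ e₂ ∶ τ → Γ ⊢ app e₁ e₂ ∶ τ′

  ⊢pair   : ∀ {τ τ′ e₁ e₂} → Γ ⊢ e₁ ∶ τ → Γ ⊢ e₂ ∶ τ′ → Γ ⊢ pair e₁ e₂ ∶ τ ⊗ τ′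
  ⊢pairᵛ  : ∀ {τ τ′ v w} → Γ ⊢ val v ∶ τ → Γ ⊢ val w ∶ τ′ →
            Γ ⊢ val (pairᵛ v w) ∶ τ ⊗ τ′
  ⊢fst    : ∀ {τ τ′ e} → Γ ⊢ e ∶ τ ⊗ τ′ → Γ ⊢ fst e ∶ τ
  ⊢snd    : ∀ {τ τ′ e} → Γ ⊢ e ∶ τ ⊗ τ′ → Γ ⊢ snd e ∶ τ′

  ⊢inl    : ∀ {τ τ′ e} → Γ ⊢ e ∶ τ → Γ ⊢ inl e ∶ τ ⊕ τ′
  ⊢inr    : ∀ {τ τ′ e} → Γ ⊢ e ∶ τ′ → Γ ⊢ inr e ∶ τ ⊕ τ′
  ⊢inlᵛ   : ∀ {τ τ′ v} → Γ ⊢ val v ∶ τ → Γ ⊢ val (inlᵛ v) ∶ τ ⊕ τ′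
  ⊢inrᵛ   : ∀ {τ τ′ v} → Γ ⊢ val v ∶ τ′ → Γ ⊢ val (inrᵛ v) ∶ τ ⊕ τ′
  ⊢case   : ∀ {τ₁ τ₂ τ e e₁ e₂} → Γ ⊢ e ∶ τ₁ ⊕ τ₂ →
            (τ₁ ∷ Γ) ⊢ e₁ ∶ τ → (τ₂ ∷ Γ) ⊢ e₂ ∶ τ → Γ ⊢ case e e₁ e₂ ∶ τ

  ⊢tlam   : ∀ {τ e} → Vec.map wkᵗ Γ ⊢ e ∶ τ → Γ ⊢ tlam e ∶ allᵗ τ
  ⊢tlamᵛ  : ∀ {τ : Ty (suc Δ)} {e} → [] ⊢ e ∶ τ → Γ ⊢ val (tlamᵛ e) ∶ allᵗ τ
  ⊢tapp   : ∀ {τ e} τ′ → Γ ⊢ e ∶ allᵗ τ → Γ ⊢ tapp e ∶ τ [ τ′ ]ᵗ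
  ⊢pack   : ∀ {τ e} τ′ → Γ ⊢ e ∶ τ [ τ′ ]ᵗ → Γ ⊢ pack e ∶ exᵗ τ
  ⊢unpack : ∀ {τ τ′ e₁ e₂} → Γ ⊢ e₁ ∶ exᵗ τ → (τ ∷ Vec.map wkᵗ Γ) ⊢ e₂ ∶ wkᵗ τ′ →
            Γ ⊢ unpack e₁ e₂ ∶ τ′
  ⊢fold   : ∀ {τ e} → Γ ⊢ e ∶ τ [ muᵗ τ ]ᵗ → Γ ⊢ fold e ∶ muᵗ τ
  ⊢unfold : ∀ {τ e} → Γ ⊢ e ∶ muᵗ τ → Γ ⊢ unfold e ∶ τ [ muᵗ τ ]ᵗ

  ⊢ref    : ∀ {τ e} → Γ ⊢ e ∶ τ → Γ ⊢ ref e ∶ refᵗ τ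
  ⊢load   : ∀ {τ e} → Γ ⊢ e ∶ refᵗ τ → Γ ⊢ load e ∶ τ
  ⊢store  : ∀ {τ e₁ e₂} → Γ ⊢ e₁ ∶ refᵗ τ → Γ ⊢ e₂ ∶ τ → Γ ⊢ store e₁ e₂ ∶ unitᵗ

  ⊢rand   : ∀ {e} → Γ ⊢ e ∶ intᵗ → Γ ⊢ rand e ∶ natᵗ
  ⊢tape   : ∀ {e} → Γ ⊢ e ∶ intᵗ → Γ ⊢ tape e ∶ tapeᵗ
  ⊢randOn : ∀ {e₁ e₂} → Γ ⊢ e₁ ∶ intᵗ → Γ ⊢ e₂ ∶ tapeᵗ → Γ ⊢ randOn e₁ e₂ ∶ natᵗ

ClosedOfType : Expr 0 → Ty 0 → Set
ClosedOfType e τ = [] ⊢ e ∶ τ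

------------------------------------------------------------------------
-- Lists and finite maps inside the language
--
-- nil = inl (), cons x l = inr (x , l); a finite map is a list of key–value
-- pairs.  Each program is preceded by its version with named variables.

private
  x₀ : ∀ {n} → Expr (1 ℕ.+ n)
  x₀ = var zero
  x₁ : ∀ {n} → Expr (2 ℕ.+ n)
  x₁ = var (suc zero)
  x₂ : ∀ {n} → Expr (3 ℕ.+ n)
  x₂ = var (suc (suc zero))
  x₃ : ∀ {n} → Expr (4 ℕ.+ n)
  x₃ = var (suc (suc (suc zero)))
  x₄ : ∀ {n} → Expr (5 ℕ.+ n)
  x₄ = var (suc (suc (suc (suc zero))))
  x₅ : ∀ {n} → Expr (6 ℕ.+ n)
  x₅ = var (suc (suc (suc (suc (suc zero)))))

nilᵛ : Val
nilᵛ = inlᵛ unitᵛ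

consᵛ : Val → Val → Val
consᵛ v w = inrᵛ (pairᵛ v w)

listᵛ : List Val → Val
listᵛ = foldr consᵛ nilᵛ

cons : ∀ {n} → Expr n → Expr n → Expr n
cons e₁ e₂ = inr (pair e₁ e₂)

-- A stuck expression, for the k-th element of a list that is too short.
stuck : ∀ {n} → Expr n
stuck = app (val unitᵛ) (val unitᵛ)

-- rec len l = case l of inl _ → 0 | inr p → 1 + len (snd p)
lengthᵛ : Val
lengthᵛ = recᵛ
  (case x₀
    (int (+ 0))
    (binop plus (int (+ 1)) (app x₂ (snd x₀))))

-- rec nth l = λ k. case l of
--   inl _ → stuck
--   inr p → if k = 0 then fst p else nth (snd p) (k - 1)
nthᵛ : Val
nthᵛ = recᵛ (lam
  (case x₁
    stuck
    (ite (binop equal x₁ (int (+ 0)))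
      (fst x₀)
      (app (app x₃ (snd x₀)) (binop minus x₁ (int (+ 1)))))))

-- rec remove l = λ k. case l of
--   inl _ → inl ()
--   inr p → if k = 0 then snd p else cons (fst p) (remove (snd p) (k - 1))
removeᵛ : Val
removeᵛ = recᵛ (lam
  (case x₁
    (val nilᵛ)
    (ite (binop equal x₁ (int (+ 0)))
      (snd x₀)
      (cons (fst x₀) (app (app x₃ (snd x₀)) (binop minus x₁ (int (+ 1))))))))

-- rec find m = λ k. case m of
--   inl _ → None
--   inr p → if fst (fst p) = k then Some (snd (fst p)) else find (snd p) k
findᵛ : Val
findᵛ = recᵛ (lam
  (case x₁
    none
    (ite (binop equal (fst (fst x₀)) x₁)
      (some (snd (fst x₀)))
      (app (app x₃ (snd x₀)) x₁))))

call₁ : ∀ {n} → Val → Expr n → Expr n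
call₁ f e = app (val f) e

call₂ : ∀ {n} → Val → Expr n → Expr n → Expr n
call₂ f e₁ e₂ = app (app (val f) e₁) e₂

-- m[k ↦ v], for k not in the domain of m
extend : ∀ {n} → Expr n → Expr n → Expr n → Expr n
extend m k v = cons (pair k v) m

------------------------------------------------------------------------
-- The programs

-- bounded Q = λ f. let c = ref 0 in
--   λ x. if !c < Q then (c ← !c + 1; Some (f x)) else None
bounded : ℕ → Expr 0 → Expr 0
bounded Q f = app
  (lam (let′ (ref (int (+ 0)))
    (lam (ite (binop less (load x₁) (int (+ Q)))
      (seq (store x₁ (binop plus (load x₁) (int (+ 1))))
           (some (app x₂ x₀)))
      none))))
  f

-- rf N = let m = ref nil in
--   λ x. case find !m x of
--     inl _ → let y = rand (N - 1) in m ← extend !m x y; y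
--     inr y → y
rf : ℕ → Expr 0
rf N =
  let′ (ref (val nilᵛ))
    (lam (case (call₂ findᵛ (load x₁) x₀)
      (let′ (rand (binop minus (int (+ N)) (int (+ 1))))
        (seq (store x₃ (extend (load x₃) x₂ x₀))
             x₀))
      x₀))

-- rp N = let m = ref nil in let u = ref [0, …, N-1] in
--   λ x. case find !m x of
--     inl _ → let k = rand (length !u - 1) in
--             let y = nth !u k in
--             m ← extend !m x y; u ← remove !u k; y
--     inr y → y
rp : ℕ → Expr 0
rp N =
  let′ (ref (val nilᵛ))
    (let′ (ref (val (listᵛ (map (λ i → intᵛ (+ i)) (upTo N)))))
      (lam (case (call₂ findᵛ (load x₂) x₀)
        (let′ (rand (binop minus (call₁ lengthᵛ (load x₂)) (int (+ 1))))
          (let′ (call₂ nthᵛ (load x₃) x₀)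
            (seq (store x₅ (extend (load x₅) x₃ x₀))
              (seq (store x₄ (call₂ removeᵛ (load x₄) x₁))
                x₀))))
        x₀)))

{-# OPTIONS --safe #-}

-- Run the two programs side by side.  Since the adversary contains no location
-- literals, its terms and values stay related by a syntactic relation under
-- which the two oracles correspond; outside oracle calls both runs take the same
-- steps.  On a fresh query with j values already used, a uniform draw from the
-- N - j unused values and a uniform draw from all N values can be coupled so
-- that they differ with probability j/N.  The j-th query therefore costs at most
-- j/N (counting from 0), and summing over j < Q gives Q(Q-1)/(2N).  The error is
-- carried through the step-indexed semantics by couplings with leftover mass,
-- a notion symmetric in the two runs, so one argument gives both inequalities.
module Submission where

open import Defs
open import Data.Bool using (Bool; true; false; if_then_else_)
open import Data.Fin as Fin using (Fin; zero; suc; toℕ)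
import Data.Fin.Properties as Fin
open import Data.Integer as ℤ using (+_; +[1+_]; -[1+_])
import Data.Integer.Properties as ℤ
import Data.Integer.Solver as ℤ-Solver
open import Data.List using (List; []; _∷_; _++_; map; length; allFin; upTo; removeAt)
import Data.List as List
import Data.List.Properties as List
open import Data.List.Relation.Binary.Permutation.Propositional as Perm using (_↭_; prep; swap)
import Data.List.Relation.Binary.Permutation.Propositional.Properties as Perm
open import Data.List.Relation.Unary.All as All using (All; []; _∷_)
import Data.List.Relation.Unary.All.Properties as All
open import Data.Maybe using (Maybe; just; nothing; maybe′)
open import Data.Maybe.Relation.Binary.Pointwise as Maybe using (just; nothing)
open import Data.Nat as ℕ using (ℕ; zero; suc; NonZero; z≤n; s≤s)
import Data.Nat.Properties as ℕ
open import Data.Nat.Properties using (m*n≢0)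
import Data.Nat.Solver as ℕ-Solver
open import Data.Product as Product using (∃; _×_; _,_; proj₁; proj₂)
open import Data.Rational as ℚ using (ℚ; 0ℚ; 1ℚ; _/_)
import Data.Rational.Properties as ℚ
import Data.Rational.Solver as ℚ-Solver
open import Data.Rational.Unnormalised as ℚᵘ using (mkℚᵘ; *≡*; *≤*)
import Data.Rational.Unnormalised.Properties as ℚᵘ
open import Data.Sum using (_⊎_; inj₁; inj₂)
open import Function using (_∘_; id; flip; case_of_)
open import Relation.Binary.Construct.Closure.ReflexiveTransitive as Star
  using (Star; ε; _◅_; _◅◅_)
open import Relation.Binary.PropositionalEquality
open import Relation.Nullary using (yes; no; does; contradiction)
open import Relation.Nullary.Decidable using (dec-true; dec-false)

-- Weighted sums

-- As `fresh` lies just above the largest location in use, every later allocation of the adversary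
-- is displaced by exactly one between the runs. The relation absorbs this shift: locations can only
-- be dereferenced, assigned and tested for equality, and equality is invariant under it.
--
-- An oracle call takes different numbers of steps on the two sides, so the step indices cannot be
-- kept equal. For each index on one side some index on the other is found, which is enough for
-- limits of nondecreasing sequences.
--
-- The relation forgets types, so the oracles must also be compared on arguments that `equal`
-- rejects; there both runs get stuck together.
--
-- The cost is charged per query, with the query counter as an upper bound for the number of used
-- values; a repeated query forfeits its share.

sumOver-map : {A B : Set} (h : A → B) (xs : List (ℚ × A)) (f : B → ℚ) →
              sumOver (map (λ (p , a) → p , h a) xs) f ≡ sumOver xs (f ∘ h)
sumOver-map h []             f = refl
sumOver-map h ((p , a) ∷ xs) f = cong (p ℚ.* f (h a) ℚ.+_) (sumOver-map h xs f)

sumOver-++ : {A : Set} (xs ys : List (ℚ × A)) (f : A → ℚ) →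
             sumOver (xs ++ ys) f ≡ sumOver xs f ℚ.+ sumOver ys f
sumOver-++ []             ys f = sym (ℚ.+-identityˡ _)
sumOver-++ ((p , a) ∷ xs) ys f =
  trans (cong (p ℚ.* f a ℚ.+_) (sumOver-++ xs ys f)) (sym (ℚ.+-assoc (p ℚ.* f a) _ _))

sumOver-↭ : {A : Set} {xs ys : List (ℚ × A)} (f : A → ℚ) →
            xs ↭ ys → sumOver xs f ≡ sumOver ys f
sumOver-↭ f Perm.refl                  = refl
sumOver-↭ f (prep (p , a) xs↭ys)       = cong (p ℚ.* f a ℚ.+_) (sumOver-↭ f xs↭ys)
sumOver-↭ {xs = _ ∷ _ ∷ xs} {ys = _ ∷ _ ∷ ys} f (swap (p , a) (q , b) xs↭ys) =
  trans (cong (λ s → p ℚ.* f a ℚ.+ (q ℚ.* f b ℚ.+ s)) (sumOver-↭ f xs↭ys))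
    (solve 3 (λ x y s → x :+ (y :+ s) := y :+ (x :+ s)) refl
      (p ℚ.* f a) (q ℚ.* f b) (sumOver ys f))
  where open ℚ-Solver.+-*-Solver
sumOver-↭ f (Perm.trans xs↭ys ys↭zs)   = trans (sumOver-↭ f xs↭ys) (sumOver-↭ f ys↭zs)

sumOver-nonNeg : {A : Set} {f : A → ℚ} → (∀ a → 0ℚ ℚ.≤ f a) →
                 (xs : List (ℚ × A)) → All (0ℚ ℚ.≤_) (weights xs) → 0ℚ ℚ.≤ sumOver xs f
sumOver-nonNeg 0≤f []             []         = ℚ.≤-refl
sumOver-nonNeg {f = f} 0≤f ((p , a) ∷ xs) (0≤p ∷ nn) =
  ℚ.+-mono-≤ (subst (ℚ._≤ p ℚ.* f a) (ℚ.*-zeroʳ p)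
               (ℚ.*-monoˡ-≤-nonNeg p {{ℚ.nonNegative 0≤p}} (0≤f a)))
             (sumOver-nonNeg 0≤f xs nn)

sumOver-mono : {A : Set} {f g : A → ℚ} → (∀ a → f a ℚ.≤ g a) →
               (xs : List (ℚ × A)) → All (0ℚ ℚ.≤_) (weights xs) → sumOver xs f ℚ.≤ sumOver xs g
sumOver-mono f≤g []             []         = ℚ.≤-refl
sumOver-mono f≤g ((p , a) ∷ xs) (0≤p ∷ nn) =
  ℚ.+-mono-≤ (ℚ.*-monoˡ-≤-nonNeg p {{ℚ.nonNegative 0≤p}} (f≤g a)) (sumOver-mono f≤g xs nn)

sumOver-≤-mass : {A : Set} {f : A → ℚ} → (∀ a → f a ℚ.≤ 1ℚ) →
                 (xs : List (ℚ × A)) → All (0ℚ ℚ.≤_) (weights xs) →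
                 sumOver xs f ℚ.≤ sumℚ (weights xs)
sumOver-≤-mass f≤1 []             []         = ℚ.≤-refl
sumOver-≤-mass {f = f} f≤1 ((p , a) ∷ xs) (0≤p ∷ nn) =
  ℚ.+-mono-≤ (subst (p ℚ.* f a ℚ.≤_) (ℚ.*-identityʳ p)
               (ℚ.*-monoˡ-≤-nonNeg p {{ℚ.nonNegative 0≤p}} (f≤1 a)))
             (sumOver-≤-mass f≤1 xs nn)

0≤1 : 0ℚ ℚ.≤ 1ℚ
0≤1 = ℚ.nonNegative⁻¹ 1ℚ

infixr 8 _⋆_

-- Repeated addition instead of a product with an embedded natural number, so that the mass of a
-- list of equal weights unfolds to it by recursion on the list.
_⋆_ : ℕ → ℚ → ℚ
zero  ⋆ p = 0ℚ
suc n ⋆ p = p ℚ.+ n ⋆ p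

⋆-+ : ∀ m n p → (m ℕ.+ n) ⋆ p ≡ m ⋆ p ℚ.+ n ⋆ p
⋆-+ zero    n p = sym (ℚ.+-identityˡ _)
⋆-+ (suc m) n p = trans (cong (p ℚ.+_) (⋆-+ m n p)) (sym (ℚ.+-assoc p _ _))

⋆-nonNeg : ∀ n {p} → 0ℚ ℚ.≤ p → 0ℚ ℚ.≤ n ⋆ p
⋆-nonNeg zero    0≤p = ℚ.≤-refl
⋆-nonNeg (suc n) 0≤p = ℚ.+-mono-≤ 0≤p (⋆-nonNeg n 0≤p)

⋆-monoˡ-≤ : ∀ {m n p} → 0ℚ ℚ.≤ p → m ℕ.≤ n → m ⋆ p ℚ.≤ n ⋆ p
⋆-monoˡ-≤ {n = n} 0≤p ℕ.z≤n     = ⋆-nonNeg n 0≤p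
⋆-monoˡ-≤ {p = p} 0≤p (ℕ.s≤s m≤n) = ℚ.+-monoʳ-≤ p (⋆-monoˡ-≤ 0≤p m≤n)

⋆-distrib-sub : ∀ n p q → n ⋆ (p ℚ.- q) ≡ n ⋆ p ℚ.- n ⋆ q
⋆-distrib-sub zero    p q = refl
⋆-distrib-sub (suc n) p q = trans (cong (p ℚ.- q ℚ.+_) (⋆-distrib-sub n p q))
  (solve 4 (λ p q s t → p :- q :+ (s :- t) := p :+ s :- (q :+ t)) refl p q (n ⋆ p) (n ⋆ q))
  where open ℚ-Solver.+-*-Solver

equally : {A B : Set} → ℚ → (A → B) → List A → List (ℚ × B)
equally p F = map (λ a → p , F a)

equally-mass : {A B : Set} (p : ℚ) (F : A → B) (xs : List A) →
               sumℚ (weights (equally p F xs)) ≡ length xs ⋆ p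
equally-mass p F []       = refl
equally-mass p F (x ∷ xs) = cong (p ℚ.+_) (equally-mass p F xs)

equally-nonNeg : {A B : Set} {p : ℚ} (F : A → B) (xs : List A) → 0ℚ ℚ.≤ p →
                 All (0ℚ ℚ.≤_) (weights (equally p F xs))
equally-nonNeg F []       0≤p = []
equally-nonNeg F (x ∷ xs) 0≤p = 0≤p ∷ equally-nonNeg F xs 0≤p

-- Divides each weight p into q and p - q. The entries of weight q may be decorated by `G`, with `g`
-- forgetting the decoration; in a coupling the decoration is the partner.
equally-split : {A B C : Set} (p q : ℚ) (F : A → B) (G : A → C) (xs : List A) (f : B → ℚ) (g : C → B) →
                (∀ a → g (G a) ≡ F a) →
                sumOver (equally p F xs) f ≡
                sumOver (equally q G xs) (f ∘ g) ℚ.+ sumOver (equally (p ℚ.- q) F xs) f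
equally-split p q F G []       f g eq = refl
equally-split p q F G (x ∷ xs) f g eq rewrite eq x =
  trans (cong (p ℚ.* f (F x) ℚ.+_) (equally-split p q F G xs f g eq))
    (solve 5 (λ p q y s t → p :* y :+ (s :+ t) := q :* y :+ s :+ ((p :- q) :* y :+ t)) refl
      p q (f (F x)) _ _)
  where open ℚ-Solver.+-*-Solver

sumOver-equally-∘ : {A B C : Set} (p : ℚ) {F : A → B} (h : B → C) (f : C → ℚ) (xs : List A) →
                    sumOver (equally p (h ∘ F) xs) f ≡ sumOver (equally p F xs) (f ∘ h)
sumOver-equally-∘ p         h f []       = refl
sumOver-equally-∘ p {F = F} h f (x ∷ xs) = cong (p ℚ.* f (h (F x)) ℚ.+_) (sumOver-equally-∘ p h f xs)

-- Unit fractions and the error budget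

-- The argument is the predecessor of the denominator, which makes the denominator visibly nonzero.
-- With N = n + 1, `1/n n` is 1/N.
1/n : ℕ → ℚ
1/n n = + 1 / suc n

0≤1/n : ∀ n → 0ℚ ℚ.≤ 1/n n
0≤1/n n = ℚ.nonNegative⁻¹ (1/n n) {{ℚ.normalize-nonNeg 1 (suc n)}}

⋆-1/n : ∀ k n → k ⋆ 1/n n ≡ + k / suc n
⋆-1/n zero    n = sym (ℚ.0/n≡0 (suc n))
⋆-1/n (suc k) n = trans (cong (1/n n ℚ.+_) (⋆-1/n k n)) (ℚ.toℚᵘ-injective (begin
  ℚ.toℚᵘ (1/n n ℚ.+ + k / suc n)
    ≈⟨ ℚ.toℚᵘ-homo-+ (1/n n) (+ k / suc n) ⟩
  ℚ.toℚᵘ (1/n n) ℚᵘ.+ ℚ.toℚᵘ (+ k / suc n)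
    ≈⟨ ℚᵘ.+-cong (ℚ.toℚᵘ-fromℚᵘ (mkℚᵘ (+ 1) n)) (ℚ.toℚᵘ-fromℚᵘ (mkℚᵘ (+ k) n)) ⟩
  mkℚᵘ (+ 1) n ℚᵘ.+ mkℚᵘ (+ k) n
    ≈⟨ *≡* (trans (cong (ℤ._* + suc n) (sym (ℤ.*-distribʳ-+ (+ suc n) (+ 1) (+ k))))
                  (trans (ℤ.*-assoc (+ suc k) (+ suc n) (+ suc n))
                         (cong (+ suc k ℤ.*_) (sym (ℤ.pos-* (suc n) (suc n)))))) ⟩
  mkℚᵘ (+ suc k) n
    ≈⟨ ℚ.toℚᵘ-fromℚᵘ (mkℚᵘ (+ suc k) n) ⟨
  ℚ.toℚᵘ (+ suc k / suc n) ∎))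
  where open ℚᵘ.≃-Reasoning

n⋆1/n : ∀ n → suc n ⋆ 1/n n ≡ 1ℚ
n⋆1/n n = trans (⋆-1/n (suc n) n)
  (ℚ.fromℚᵘ-cong {mkℚᵘ (+ suc n) n} {mkℚᵘ (+ 1) 0} (*≡* (ℤ.*-comm (+ suc n) (+ 1))))

1/n-antitone : ∀ {m n} → m ℕ.≤ n → 1/n n ℚ.≤ 1/n m
1/n-antitone {m} {n} m≤n = ℚ.toℚᵘ-cancel-≤ (begin
  ℚ.toℚᵘ (1/n n)  ≃⟨ ℚ.toℚᵘ-fromℚᵘ (mkℚᵘ (+ 1) n) ⟩
  mkℚᵘ (+ 1) n    ≤⟨ *≤* (ℤ.*-monoˡ-≤-nonNeg (+ 1) (ℤ.+≤+ (ℕ.s≤s m≤n))) ⟩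
  mkℚᵘ (+ 1) m    ≃⟨ ℚ.toℚᵘ-fromℚᵘ (mkℚᵘ (+ 1) m) ⟨
  ℚ.toℚᵘ (1/n m)  ∎)
  where open ℚᵘ.≤-Reasoning

-- The advantage that the last d of k + d queries can still give to the adversary.

budget : ℕ → ℕ → ℕ → ℚ
budget n zero    k = 0ℚ
budget n (suc d) k = k ⋆ 1/n n ℚ.+ budget n d (suc k)

budget-nonNeg : ∀ n d k → 0ℚ ℚ.≤ budget n d k
budget-nonNeg n zero    k = ℚ.≤-refl
budget-nonNeg n (suc d) k = ℚ.+-mono-≤ (⋆-nonNeg k (0≤1/n n)) (budget-nonNeg n d (suc k))

triangle : ℕ → ℕ → ℕ
triangle zero    k = 0
triangle (suc d) k = k ℕ.+ triangle d (suc k)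

budget≡triangle : ∀ n d k → budget n d k ≡ triangle d k ⋆ 1/n n
budget≡triangle n zero    k = refl
budget≡triangle n (suc d) k = trans (cong (k ⋆ 1/n n ℚ.+_) (budget≡triangle n d (suc k)))
                                    (sym (⋆-+ k (triangle d (suc k)) (1/n n)))

-- The sum k + (k+1) + ... + (k+d-1) is dk + d(d-1)/2. Doubling it and moving d to the left avoids
-- both division and truncated subtraction.
triangle-double : ∀ d k → 2 ℕ.* triangle d k ℕ.+ d ≡ d ℕ.* (d ℕ.+ 2 ℕ.* k)
triangle-double zero    k = refl
triangle-double (suc d) k = begin
  2 ℕ.* (k ℕ.+ triangle d (suc k)) ℕ.+ suc d
    ≡⟨ solve 3 (λ k t d → con 2 :* (k :+ t) :+ (con 1 :+ d) := con 2 :* k :+ con 1 :+ (con 2 :* t :+ d))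
         refl k (triangle d (suc k)) d ⟩
  2 ℕ.* k ℕ.+ 1 ℕ.+ (2 ℕ.* triangle d (suc k) ℕ.+ d)
    ≡⟨ cong (2 ℕ.* k ℕ.+ 1 ℕ.+_) (triangle-double d (suc k)) ⟩
  2 ℕ.* k ℕ.+ 1 ℕ.+ d ℕ.* (d ℕ.+ 2 ℕ.* suc k)
    ≡⟨ solve 2 (λ k d → con 2 :* k :+ con 1 :+ d :* (d :+ con 2 :* (con 1 :+ k))
                        := (con 1 :+ d) :* (con 1 :+ d :+ con 2 :* k)) refl k d ⟩
  suc d ℕ.* (suc d ℕ.+ 2 ℕ.* k) ∎
  where open ≡-Reasoning
        open ℕ-Solver.+-*-Solver

budget-total : ∀ n Q → budget n Q 0 ≡ _/_ (+ Q ℤ.* (+ Q ℤ.- + 1)) (2 ℕ.* suc n) {{m*n≢0 2 (suc n)}}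
budget-total n Q = trans (budget≡triangle n Q 0) (trans (⋆-1/n (triangle Q 0) n)
  -- `mkℚᵘ` takes the denominator minus one, and `2 * suc n` computes to `suc (n + suc (n + 0))`.
  (ℚ.fromℚᵘ-cong {mkℚᵘ (+ triangle Q 0) n} {mkℚᵘ (+ Q ℤ.* (+ Q ℤ.- + 1)) (n ℕ.+ suc (n ℕ.+ 0))}
    (*≡* (begin
      + t ℤ.* + (2 ℕ.* suc n)             ≡⟨ cong (+ t ℤ.*_) (ℤ.pos-* 2 (suc n)) ⟩
      + t ℤ.* (+ 2 ℤ.* + suc n)           ≡⟨ ℤ.*-assoc (+ t) (+ 2) (+ suc n) ⟨
      + t ℤ.* + 2 ℤ.* + suc n             ≡⟨ cong (ℤ._* + suc n) 2t≡Q[Q-1] ⟩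
      + Q ℤ.* (+ Q ℤ.- + 1) ℤ.* + suc n   ∎))))
  where
  open ≡-Reasoning
  open ℤ-Solver.+-*-Solver
  t = triangle Q 0

  2t≡Q[Q-1] : + t ℤ.* + 2 ≡ + Q ℤ.* (+ Q ℤ.- + 1)
  2t≡Q[Q-1] = begin
    + t ℤ.* + 2
      -- Q is added and subtracted to produce the left side of `triangle-double`.
      ≡⟨ solve 2 (λ t q → t :* con (+ 2) := con (+ 2) :* t :+ q :- q) refl (+ t) (+ Q) ⟩
    + 2 ℤ.* + t ℤ.+ + Q ℤ.- + Q
      ≡⟨ cong (λ z → z ℤ.+ + Q ℤ.- + Q) (sym (ℤ.pos-* 2 t)) ⟩
    + (2 ℕ.* t ℕ.+ Q) ℤ.- + Q
      ≡⟨ cong (λ m → + m ℤ.- + Q) (trans (triangle-double Q 0) (cong (Q ℕ.*_) (ℕ.+-identityʳ Q))) ⟩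
    + (Q ℕ.* Q) ℤ.- + Q
      ≡⟨ cong (ℤ._- + Q) (ℤ.pos-* Q Q) ⟩
    + Q ℤ.* + Q ℤ.- + Q
      ≡⟨ solve 1 (λ q → q :* q :- q := q :* (q :- con (+ 1))) refl (+ Q) ⟩
    + Q ℤ.* (+ Q ℤ.- + 1) ∎

-- Couplings

-- The marginals are compared through the sums of all functions, since outcome lists that differ in
-- order or grouping represent the same distribution. Both remainders obey the same bound δ, which
-- is what makes the notion symmetric.
record Coupling {A B : Set} (R : A → B → Set) (δ : ℚ)
                (xs : List (ℚ × A)) (ys : List (ℚ × B)) : Set where
  field
    matched        : List (ℚ × A × B)
    restˡ          : List (ℚ × A)
    restʳ          : List (ℚ × B)
    splitˡ         : ∀ f → sumOver xs f ≡ sumOver matched (f ∘ proj₁) ℚ.+ sumOver restˡ f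
    splitʳ         : ∀ f → sumOver ys f ≡ sumOver matched (f ∘ proj₂) ℚ.+ sumOver restʳ f
    matched-nonNeg : All (0ℚ ℚ.≤_) (weights matched)
    restˡ-nonNeg   : All (0ℚ ℚ.≤_) (weights restˡ)
    restʳ-nonNeg   : All (0ℚ ℚ.≤_) (weights restʳ)
    matched-mass   : sumℚ (weights matched) ℚ.≤ 1ℚ
    restˡ-mass     : sumℚ (weights restˡ) ℚ.≤ δ
    restʳ-mass     : sumℚ (weights restʳ) ℚ.≤ δ
    related        : All (λ (_ , a , b) → R a b) matched

bimap-coupling : {A B C D : Set} {R : A → B → Set} {S : C → D → Set} {δ : ℚ}
                 {xs : List (ℚ × A)} {ys : List (ℚ × B)} {h : A → C} {k : B → D} →
                 (∀ {a b} → R a b → S (h a) (k b)) → Coupling R δ xs ys →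
                 Coupling S δ (map (λ (p , a) → p , h a) xs) (map (λ (p , b) → p , k b) ys)
bimap-coupling {xs = xs} {ys} {h} {k} R⇒S c = record
  { matched        = map (λ (p , ab) → p , Product.map h k ab) matched
  ; restˡ          = map (λ (p , a) → p , h a) restˡ
  ; restʳ          = map (λ (p , b) → p , k b) restʳ
  ; splitˡ         = λ f → trans (sumOver-map h xs f) (trans (splitˡ (f ∘ h))
                       (cong₂ ℚ._+_ (sym (sumOver-map (Product.map h k) matched (f ∘ proj₁)))
                                    (sym (sumOver-map h restˡ f))))
  ; splitʳ         = λ f → trans (sumOver-map k ys f) (trans (splitʳ (f ∘ k))
                       (cong₂ ℚ._+_ (sym (sumOver-map (Product.map h k) matched (f ∘ proj₂)))
                                    (sym (sumOver-map k restʳ f))))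
  ; matched-nonNeg = subst (All (0ℚ ℚ.≤_)) (sym (weights-map (Product.map h k) matched)) matched-nonNeg
  ; restˡ-nonNeg   = subst (All (0ℚ ℚ.≤_)) (sym (weights-map h restˡ)) restˡ-nonNeg
  ; restʳ-nonNeg   = subst (All (0ℚ ℚ.≤_)) (sym (weights-map k restʳ)) restʳ-nonNeg
  ; matched-mass   = subst (λ ws → sumℚ ws ℚ.≤ 1ℚ) (sym (weights-map (Product.map h k) matched)) matched-mass
  ; restˡ-mass     = subst (λ ws → sumℚ ws ℚ.≤ _) (sym (weights-map h restˡ)) restˡ-mass
  ; restʳ-mass     = subst (λ ws → sumℚ ws ℚ.≤ _) (sym (weights-map k restʳ)) restʳ-mass
  ; related        = All.map⁺ (All.map R⇒S related)
  }
  where open Coupling c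

flip-coupling : {A B : Set} {R : A → B → Set} {S : B → A → Set} {δ : ℚ}
                {xs : List (ℚ × A)} {ys : List (ℚ × B)} → (∀ {a b} → R a b → S b a) →
                Coupling R δ xs ys → Coupling S δ ys xs
flip-coupling R⇒S c = record
  { matched        = map (λ (p , ab) → p , Product.swap ab) matched
  ; restˡ          = restʳ
  ; restʳ          = restˡ
  ; splitˡ         = λ f → trans (splitʳ f)
                       (cong (ℚ._+ _) (sym (sumOver-map Product.swap matched (f ∘ proj₁))))
  ; splitʳ         = λ f → trans (splitˡ f)
                       (cong (ℚ._+ _) (sym (sumOver-map Product.swap matched (f ∘ proj₂))))
  ; matched-nonNeg = subst (All (0ℚ ℚ.≤_)) (sym (weights-map Product.swap matched)) matched-nonNeg
  ; restˡ-nonNeg   = restʳ-nonNeg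
  ; restʳ-nonNeg   = restˡ-nonNeg
  ; matched-mass   = subst (λ ws → sumℚ ws ℚ.≤ 1ℚ) (sym (weights-map Product.swap matched)) matched-mass
  ; restˡ-mass     = restʳ-mass
  ; restʳ-mass     = restˡ-mass
  ; related        = All.map⁺ (All.map R⇒S related)
  }
  where open Coupling c

empty-coupling : {A B : Set} {R : A → B → Set} → Coupling R 0ℚ [] []
empty-coupling = record
  { matched = [] ; restˡ = [] ; restʳ = [] ; splitˡ = λ _ → refl ; splitʳ = λ _ → refl
  ; matched-nonNeg = [] ; restˡ-nonNeg = [] ; restʳ-nonNeg = []
  ; matched-mass = 0≤1 ; restˡ-mass = ℚ.≤-refl ; restʳ-mass = ℚ.≤-refl
  ; related = [] }

equally-coupling : {A B C : Set} {R : B → C → Set} {p : ℚ} {F : A → B} {G : A → C} (is : List A) →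
                   0ℚ ℚ.≤ p → length is ⋆ p ℚ.≤ 1ℚ → (∀ i → R (F i) (G i)) →
                   Coupling R 0ℚ (equally p F is) (equally p G is)
equally-coupling {R = R} {p} {F} {G} is 0≤p mass rel = record
  { matched        = equally p (λ i → F i , G i) is
  ; restˡ          = []
  ; restʳ          = []
  ; splitˡ         = λ f → trans (sumOver-equally-∘ p proj₁ f is) (sym (ℚ.+-identityʳ _))
  ; splitʳ         = λ f → trans (sumOver-equally-∘ p proj₂ f is) (sym (ℚ.+-identityʳ _))
  ; matched-nonNeg = equally-nonNeg _ is 0≤p
  ; restˡ-nonNeg   = []
  ; restʳ-nonNeg   = []
  ; matched-mass   = subst (ℚ._≤ 1ℚ) (sym (equally-mass p _ is)) mass
  ; restˡ-mass     = ℚ.≤-refl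
  ; restʳ-mass     = ℚ.≤-refl
  ; related        = All.map⁺ (All.universal rel is)
  }

dret-coupling : {A B : Set} {R : A → B → Set} {a : A} {b : B} → R a b →
                Coupling R 0ℚ ((1ℚ , a) ∷ []) ((1ℚ , b) ∷ [])
dret-coupling {a = a} {b} r =
  equally-coupling {F = λ _ → a} {λ _ → b} (true ∷ []) 0≤1 ℚ.≤-refl (λ _ → r)

unmatched : {A B : Set} {R : A → B → Set} {δ : ℚ} (μ : SubDist A) (ν : SubDist B) → 1ℚ ℚ.≤ δ →
            Coupling R δ (outcomes μ) (outcomes ν)
unmatched μ ν 1≤δ = record
  { matched = [] ; restˡ = outcomes μ ; restʳ = outcomes ν
  ; splitˡ = λ _ → sym (ℚ.+-identityˡ _) ; splitʳ = λ _ → sym (ℚ.+-identityˡ _)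
  ; matched-nonNeg = [] ; restˡ-nonNeg = nonNeg μ ; restʳ-nonNeg = nonNeg ν
  ; matched-mass = 0≤1
  ; restˡ-mass = ℚ.≤-trans (mass≤1 μ) 1≤δ ; restʳ-mass = ℚ.≤-trans (mass≤1 ν) 1≤δ
  ; related = [] }

-- Each index i of the left draw is matched, with the smaller weight 1/(n+1), to
-- the right draw of the value stored at i; what is left on both sides is the
-- weight of the used values.
draw-coupling : ∀ {A B : Set} {R : A → B → Set} {n} (us used : List (Fin (suc n))) {m} →
                (eq : length us ≡ suc m) → us ++ used ↭ allFin (suc n) →
                (F : Fin (suc m) → A) (G : Fin (suc n) → B) →
                (∀ i → R (F i) (G (List.lookup us (Fin.cast (sym eq) i)))) →
                Coupling R (length used ⋆ 1/n n)
                  (equally (1/n m) F (allFin (suc m))) (equally (1/n n) G (allFin (suc n)))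
draw-coupling {R = R} {n} us used {m} eq perm F G rel = record
  { matched        = equally a FG is
  ; restˡ          = equally (b ℚ.- a) F is
  ; restʳ          = equally a G used
  ; splitˡ         = λ f → equally-split b a F FG is f proj₁ (λ _ → refl)
  ; splitʳ         = splitʳ
  ; matched-nonNeg = equally-nonNeg FG is (0≤1/n n)
  ; restˡ-nonNeg   = equally-nonNeg F is (subst (ℚ._≤ b ℚ.- a) (ℚ.+-inverseʳ a)
                       (ℚ.+-monoˡ-≤ (ℚ.- a) (1/n-antitone m≤n)))
  ; restʳ-nonNeg   = equally-nonNeg G used (0≤1/n n)
  ; matched-mass   = begin
      sumℚ (weights (equally a FG is))  ≡⟨ equally-mass a FG is ⟩
      length is ⋆ a                     ≡⟨ cong (_⋆ a) (List.length-tabulate {n = suc m} id) ⟩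
      suc m ⋆ a                         ≤⟨ ⋆-monoˡ-≤ (0≤1/n n) (s≤s m≤n) ⟩
      suc n ⋆ a                         ≡⟨ n⋆1/n n ⟩
      1ℚ                                ∎
  -- Both draws have total mass 1, so what the left one keeps unmatched is what the right one puts
  -- on the used values.
  ; restˡ-mass     = ℚ.≤-reflexive (begin-equality
      sumℚ (weights (equally (b ℚ.- a) F is))  ≡⟨ equally-mass (b ℚ.- a) F is ⟩
      length is ⋆ (b ℚ.- a)                    ≡⟨ cong (_⋆ (b ℚ.- a)) (List.length-tabulate {n = suc m} id) ⟩
      suc m ⋆ (b ℚ.- a)                        ≡⟨ ⋆-distrib-sub (suc m) b a ⟩
      suc m ⋆ b ℚ.- suc m ⋆ a                  ≡⟨ cong (ℚ._- suc m ⋆ a) (trans (n⋆1/n m) (sym (n⋆1/n n))) ⟩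
      suc n ⋆ a ℚ.- suc m ⋆ a                  ≡⟨ cong (λ k → k ⋆ a ℚ.- suc m ⋆ a) (sym lengths) ⟩
      (suc m ℕ.+ length used) ⋆ a ℚ.- suc m ⋆ a
        ≡⟨ cong (ℚ._- suc m ⋆ a) (⋆-+ (suc m) (length used) a) ⟩
      suc m ⋆ a ℚ.+ length used ⋆ a ℚ.- suc m ⋆ a
        ≡⟨ solve 2 (λ x y → x :+ y :- x := y) refl (suc m ⋆ a) (length used ⋆ a) ⟩
      length used ⋆ a ∎)
  ; restʳ-mass     = ℚ.≤-reflexive (equally-mass a G used)
  ; related        = All.map⁺ (All.universal rel is)
  }
  where
  open ℚ.≤-Reasoning
  open ℚ-Solver.+-*-Solver
  a  = 1/n n
  b  = 1/n m
  is = allFin (suc m)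
  at = λ i → List.lookup us (Fin.cast (sym eq) i)
  FG = λ i → F i , G (at i)

  lengths : suc m ℕ.+ length used ≡ suc n
  lengths = trans (cong (ℕ._+ length used) (sym eq)) (trans (sym (List.length-++ us))
    (trans (Perm.↭-length perm) (List.length-tabulate {n = suc n} id)))

  m≤n : m ℕ.≤ n
  m≤n = ℕ.s≤s⁻¹ (subst (suc m ℕ.≤_) lengths (ℕ.m≤m+n (suc m) (length used)))

  map-at : map at is ≡ us
  map-at = trans (List.map-tabulate id at) (tabulate-cast eq)
    where
    -- With the length generalised to a variable `k` the equation can be matched with `refl`, which
    -- removes the cast.
    tabulate-cast : ∀ {k} (eq : length us ≡ k) →
                    List.tabulate {n = k} (λ i → List.lookup us (Fin.cast (sym eq) i)) ≡ us
    tabulate-cast refl = trans (List.tabulate-cong (λ i → cong (List.lookup us) (Fin.cast-is-id refl i)))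
                               (List.tabulate-lookup us)

  splitʳ : ∀ f → sumOver (equally a G (allFin (suc n))) f ≡
                 sumOver (equally a FG is) (f ∘ proj₂) ℚ.+ sumOver (equally a G used) f
  splitʳ f = begin-equality
    sumOver (equally a G (allFin (suc n))) f
      ≡⟨ sumOver-↭ f (Perm.map⁺ _ (Perm.↭-sym perm)) ⟩
    sumOver (equally a G (us ++ used)) f
      ≡⟨ cong (λ xs → sumOver xs f) (List.map-++ _ us used) ⟩
    sumOver (equally a G us ++ equally a G used) f
      ≡⟨ sumOver-++ (equally a G us) (equally a G used) f ⟩
    sumOver (equally a G us) f ℚ.+ sumOver (equally a G used) f
      ≡⟨ cong (λ xs → sumOver (equally a G xs) f ℚ.+ sumOver (equally a G used) f) map-at ⟨
    sumOver (equally a G (map at is)) f ℚ.+ sumOver (equally a G used) f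
      ≡⟨ cong (λ xs → sumOver xs f ℚ.+ sumOver (equally a G used) f) (List.map-∘ {g = λ x → a , G x} {f = at} is) ⟨
    sumOver (equally a (G ∘ at) is) f ℚ.+ sumOver (equally a G used) f
      ≡⟨ cong (ℚ._+ sumOver (equally a G used) f) (sumOver-equally-∘ a proj₂ f is) ⟩
    sumOver (equally a FG is) (f ∘ proj₂) ℚ.+ sumOver (equally a G used) f ∎

coupling-bound : {A B : Set} {R : A → B → Set} {δ : ℚ} {xs : List (ℚ × A)} {ys : List (ℚ × B)} →
                 Coupling R δ xs ys →
                 (f : A → ℚ) → (∀ a → f a ℚ.≤ 1ℚ) →
                 (g : ℕ → B → ℚ) → (∀ m b → 0ℚ ℚ.≤ g m b) → (∀ {m n} b → m ℕ.≤ n → g m b ℚ.≤ g n b) →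
                 (r : ℚ) → 0ℚ ℚ.≤ r → (∀ {a b} → R a b → ∃ λ m → f a ℚ.≤ g m b ℚ.+ r) →
                 ∃ λ m → sumOver xs f ℚ.≤ sumOver ys (g m) ℚ.+ (δ ℚ.+ r)
coupling-bound {A} {B} {R} {δ} {xs} {ys} c f f≤1 g 0≤g g-mono r 0≤r dom =
  let m , bound = go matched matched-nonNeg related in m , (begin
    sumOver xs f
      ≡⟨ splitˡ f ⟩
    sumOver matched (f ∘ proj₁) ℚ.+ sumOver restˡ f
      ≤⟨ ℚ.+-mono-≤ bound (ℚ.≤-trans (sumOver-≤-mass f≤1 restˡ restˡ-nonNeg) restˡ-mass) ⟩
    sumOver matched (g m ∘ proj₂) ℚ.+ sumℚ (weights matched) ℚ.* r ℚ.+ δ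
      ≤⟨ ℚ.+-monoˡ-≤ δ (ℚ.+-monoʳ-≤ (sumOver matched (g m ∘ proj₂))
           (ℚ.*-monoʳ-≤-nonNeg r {{ℚ.nonNegative 0≤r}} matched-mass)) ⟩
    sumOver matched (g m ∘ proj₂) ℚ.+ 1ℚ ℚ.* r ℚ.+ δ
      ≡⟨ solve 3 (λ s r d → s :+ con 1ℚ :* r :+ d := s :+ con 0ℚ :+ (d :+ r)) refl
           (sumOver matched (g m ∘ proj₂)) r δ ⟩
    sumOver matched (g m ∘ proj₂) ℚ.+ 0ℚ ℚ.+ (δ ℚ.+ r)
      ≤⟨ ℚ.+-monoˡ-≤ (δ ℚ.+ r) (ℚ.+-monoʳ-≤ (sumOver matched (g m ∘ proj₂))
           (sumOver-nonNeg (0≤g m) restʳ restʳ-nonNeg)) ⟩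
    sumOver matched (g m ∘ proj₂) ℚ.+ sumOver restʳ (g m) ℚ.+ (δ ℚ.+ r)
      ≡⟨ cong (ℚ._+ (δ ℚ.+ r)) (splitʳ (g m)) ⟨
    sumOver ys (g m) ℚ.+ (δ ℚ.+ r) ∎)
  where
  open Coupling c
  open ℚ.≤-Reasoning
  open ℚ-Solver.+-*-Solver
  go : (zs : List (ℚ × A × B)) → All (0ℚ ℚ.≤_) (weights zs) → All (λ (_ , a , b) → R a b) zs →
       ∃ λ m → sumOver zs (f ∘ proj₁) ℚ.≤ sumOver zs (g m ∘ proj₂) ℚ.+ sumℚ (weights zs) ℚ.* r
  go [] [] [] = 0 , ℚ.≤-reflexive (sym (trans (ℚ.+-identityˡ _) (ℚ.*-zeroˡ r)))
  go ((p , a , b) ∷ zs) (0≤p ∷ 0≤zs) (rel ∷ rels) =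
    let m₁ , h₁ = dom rel
        m₂ , h₂ = go zs 0≤zs rels
        m       = m₁ ℕ.⊔ m₂
    in m , (begin
      p ℚ.* f a ℚ.+ sumOver zs (f ∘ proj₁)
        ≤⟨ ℚ.+-mono-≤
             (ℚ.*-monoˡ-≤-nonNeg p {{ℚ.nonNegative 0≤p}}
               (ℚ.≤-trans h₁ (ℚ.+-monoˡ-≤ r (g-mono b (ℕ.m≤m⊔n m₁ m₂)))))
             (ℚ.≤-trans h₂ (ℚ.+-monoˡ-≤ (sumℚ (weights zs) ℚ.* r)
               (sumOver-mono (λ ab → g-mono (proj₂ ab) (ℕ.m≤n⊔m m₁ m₂)) zs 0≤zs))) ⟩
      p ℚ.* (g m b ℚ.+ r) ℚ.+ (sumOver zs (g m ∘ proj₂) ℚ.+ sumℚ (weights zs) ℚ.* r)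
        ≡⟨ solve 5 (λ p x r s w → p :* (x :+ r) :+ (s :+ w :* r) := p :* x :+ s :+ (p :+ w) :* r) refl
             p (g m b) r (sumOver zs (g m ∘ proj₂)) (sumℚ (weights zs)) ⟩
      p ℚ.* g m b ℚ.+ sumOver zs (g m ∘ proj₂) ℚ.+ (p ℚ.+ sumℚ (weights zs)) ℚ.* r ∎)

-- Deterministic runs

infix 4 _↦_ _↦*_

data _↦_ : Cfg → Cfg → Set where
  det : ∀ {e σ ρ} → value? e ≡ nothing → outcomes (step e σ) ≡ (1ℚ , ρ) ∷ [] → (e , σ) ↦ ρ

_↦*_ : Cfg → Cfg → Set
_↦*_ = Star _↦_

execₙ-suc : ∀ n e σ v → value? e ≡ nothing →
            execₙ (suc n) (e , σ) v ≡ sumOver (outcomes (step e σ)) (λ ρ → execₙ n ρ v)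
execₙ-suc n e σ v eq rewrite eq = refl

execₙ-det : ∀ n {ρ ρ′} v → ρ ↦ ρ′ → execₙ (suc n) ρ v ≡ execₙ n ρ′ v
execₙ-det n v (det {e} {σ} {ρ} nv eq) = trans (execₙ-suc n e σ v nv)
  (trans (cong (λ xs → sumOver xs (λ ρ → execₙ n ρ v)) eq)
         (trans (ℚ.+-identityʳ _) (ℚ.*-identityˡ (execₙ n ρ v))))

execₙ-mono-≤ : ∀ {m n} ρ v → m ℕ.≤ n → execₙ m ρ v ℚ.≤ execₙ n ρ v
execₙ-mono-≤ {m} ρ v m≤n = go (ℕ.≤⇒≤′ m≤n)
  where
  go : ∀ {n} → m ℕ.≤′ n → execₙ m ρ v ℚ.≤ execₙ n ρ v
  go ℕ.≤′-refl            = ℚ.≤-refl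
  go (ℕ.≤′-step {n} m≤′n) = ℚ.≤-trans (go m≤′n) (execₙ-mono n ρ v)

pointMass≤1 : ∀ w v → pointMass w v ℚ.≤ 1ℚ
pointMass≤1 w v with does (w ≟ᵛ v)
... | true  = ℚ.≤-refl
... | false = 0≤1

execₙ≤1 : ∀ n ρ v → execₙ n ρ v ℚ.≤ 1ℚ
execₙ≤1 zero    (e , σ) v with value? e
... | just w  = pointMass≤1 w v
... | nothing = 0≤1
execₙ≤1 (suc n) (e , σ) v with value? e
... | just w  = pointMass≤1 w v
... | nothing = ℚ.≤-trans (sumOver-≤-mass {f = λ ρ → execₙ n ρ v} (λ ρ → execₙ≤1 n ρ v) _ (nonNeg (step e σ)))
                          (mass≤1 (step e σ))

-- Monotonicity supplies one unit of fuel and the deterministic step spends it, so the index does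
-- not change. In the converse direction each step has to be paid for, whence the existential in
-- `execₙ-run-≥`.
execₙ-run-≤ : ∀ n {ρ ρ′} v → ρ ↦* ρ′ → execₙ n ρ v ℚ.≤ execₙ n ρ′ v
execₙ-run-≤ n     v ε        = ℚ.≤-refl
execₙ-run-≤ n {ρ} v (s ◅ ss) = ℚ.≤-trans (execₙ-mono n ρ v)
  (ℚ.≤-trans (ℚ.≤-reflexive (execₙ-det n v s)) (execₙ-run-≤ n v ss))

execₙ-run-≥ : ∀ n {ρ ρ′} v → ρ ↦* ρ′ → ∃ λ m → execₙ n ρ′ v ℚ.≤ execₙ m ρ v
execₙ-run-≥ n v ε        = n , ℚ.≤-refl
execₙ-run-≥ n v (s ◅ ss) = let m , h = execₙ-run-≥ n v ss in
  suc m , ℚ.≤-trans h (ℚ.≤-reflexive (sym (execₙ-det m v s)))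

-- Simulations up to an error

next : Cfg → List (ℚ × Cfg)
next (e , σ) = outcomes (step e σ)

Running : Cfg → Set
Running (e , σ) = value? e ≡ nothing

Eventually : (Cfg → Cfg → Set) → Cfg → Cfg → Set
Eventually R ρ ρ′ = ∃ λ ρ₁ → ∃ λ ρ₁′ → ρ ↦* ρ₁ × ρ′ ↦* ρ₁′ × R ρ₁ ρ₁′

-- One coupled step, between deterministic runs whose lengths may differ on the two sides. The error
-- r pays for the unmatched mass `loss` of this step and for the error `left` with which the pairs
-- continue. The coupled step is taken by running configurations, so it consumes a unit of fuel and
-- allows induction.
record Advance (R : ℚ → Cfg → Cfg → Set) (r : ℚ) (ρ ρ′ : Cfg) : Set where
  constructor advance
  field
    {mid mid′} : Cfg
    run        : ρ ↦* mid
    run′       : ρ′ ↦* mid′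
    running    : Running mid
    running′   : Running mid′
    {loss left} : ℚ
    0≤left     : 0ℚ ℚ.≤ left
    loss+left≤ : loss ℚ.+ left ℚ.≤ r
    coupling   : Coupling (Eventually (R left)) loss (next mid) (next mid′)

Agree : Val → Cfg → Cfg → Set
Agree v ρ ρ′ = ∀ n → execₙ n ρ v ≡ execₙ n ρ′ v

record Simulation (v : Val) (R : ℚ → Cfg → Cfg → Set) : Set where
  field
    error-nonNeg : ∀ {r ρ ρ′} → R r ρ ρ′ → 0ℚ ℚ.≤ r
    progress     : ∀ {r ρ ρ′} → R r ρ ρ′ → Agree v ρ ρ′ ⊎ Advance R r ρ ρ′

flip-simulation : ∀ {v R} → Simulation v R → Simulation v (λ r → flip (R r))
flip-simulation {v} {R} sim = record
  { error-nonNeg = error-nonNeg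
  ; progress     = λ r → case progress r of λ where
      (inj₁ agree) → inj₁ (λ n → sym (agree n))
      (inj₂ adv)   → inj₂ (flip-advance adv)
  }
  where
  open Simulation sim
  flip-advance : ∀ {r ρ ρ′} → Advance R r ρ ρ′ → Advance (λ r → flip (R r)) r ρ′ ρ
  flip-advance (advance run run′ nv nv′ 0≤ le c) = advance run′ run nv′ nv 0≤ le
    (flip-coupling (λ (ρ₁ , ρ₁′ , s , s′ , rel) → ρ₁′ , ρ₁ , s′ , s , rel) c)

-- Induction on the left fuel n: the deterministic runs on the left are free and the coupled step
-- uses one unit. The fuel on the right is chosen afterwards and may be as large as its runs
-- require.
simulation-bound : ∀ {v R} → Simulation v R →
                   ∀ n {r ρ ρ′} → R r ρ ρ′ → ∃ λ m → execₙ n ρ v ℚ.≤ execₙ m ρ′ v ℚ.+ r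
simulation-bound {v} {R} sim = go
  where
  open Simulation sim
  open ℚ.≤-Reasoning

  weaken-≤ : ∀ {p q r} → 0ℚ ℚ.≤ r → p ℚ.≤ q → p ℚ.≤ q ℚ.+ r
  weaken-≤ {p} 0≤r p≤q = subst (ℚ._≤ _) (ℚ.+-identityʳ p) (ℚ.+-mono-≤ p≤q 0≤r)

  execₙ-zero : ∀ ρ → Running ρ → execₙ 0 ρ v ≡ 0ℚ
  execₙ-zero (e , σ) nv rewrite nv = refl

  go : ∀ n {r ρ ρ′} → R r ρ ρ′ → ∃ λ m → execₙ n ρ v ℚ.≤ execₙ m ρ′ v ℚ.+ r
  go n rel with progress rel
  go n rel | inj₁ agree = n , weaken-≤ (error-nonNeg rel) (ℚ.≤-reflexive (agree n))
  -- `mid` is still running, so without fuel it contributes 0.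
  go zero {r} {ρ} {ρ′} rel | inj₂ (advance {mid} run _ nv _ _ _ _) =
    0 , weaken-≤ (error-nonNeg rel) (begin
      execₙ 0 ρ v    ≤⟨ execₙ-run-≤ 0 v run ⟩
      execₙ 0 mid v   ≡⟨ execₙ-zero mid nv ⟩
      0ℚ             ≤⟨ execₙ-nonNeg 0 ρ′ v ⟩
      execₙ 0 ρ′ v   ∎)
  go (suc n) {r} {ρ} {ρ′} rel
    | inj₂ (advance {e , σ} {e′ , σ′} run run′ nv nv′ {loss} {left} 0≤left le c) =
    let m , h  = coupling-bound c (λ ρ → execₙ n ρ v) (λ ρ → execₙ≤1 n ρ v)
                   (λ m ρ → execₙ m ρ v) (λ m ρ → execₙ-nonNeg m ρ v) (λ ρ → execₙ-mono-≤ ρ v)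
                   left 0≤left eventually
        M , h′ = execₙ-run-≥ (suc m) v run′
    in M , (begin
      execₙ (suc n) ρ v
        ≤⟨ execₙ-run-≤ (suc n) v run ⟩
      execₙ (suc n) (e , σ) v
        ≡⟨ execₙ-suc n e σ v nv ⟩
      sumOver (next (e , σ)) (λ ρ → execₙ n ρ v)
        ≤⟨ h ⟩
      sumOver (next (e′ , σ′)) (λ ρ → execₙ m ρ v) ℚ.+ (loss ℚ.+ left)
        ≡⟨ cong (ℚ._+ (loss ℚ.+ left)) (execₙ-suc m e′ σ′ v nv′) ⟨
      execₙ (suc m) (e′ , σ′) v ℚ.+ (loss ℚ.+ left)
        ≤⟨ ℚ.+-mono-≤ h′ le ⟩
      execₙ M ρ′ v ℚ.+ r ∎)
    where
    eventually : ∀ {ρ ρ′} → Eventually (R left) ρ ρ′ →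
                 ∃ λ m → execₙ n ρ v ℚ.≤ execₙ m ρ′ v ℚ.+ left
    eventually (ρ₁ , ρ₁′ , run , run′ , rel) =
      let m , h  = go n rel
          M , h′ = execₙ-run-≥ m v run′
      in M , ℚ.≤-trans (execₙ-run-≤ n v run) (ℚ.≤-trans h (ℚ.+-monoˡ-≤ left h′))

-- Evaluation contexts

-- Evaluation is right to left: a frame ending in `R` has its hole on the right of an unevaluated
-- operand, one ending in `L` on the left of a finished value.
data Frame : Set where
  appR    : Expr 0 → Frame
  appL    : Val → Frame
  binopR  : BinOp → Expr 0 → Frame
  binopL  : BinOp → Val → Frame
  iteF    : Expr 0 → Expr 0 → Frame
  pairR   : Expr 0 → Frame
  pairL   : Val → Frame
  fstF sndF inlF inrF : Frame
  caseF   : Expr 1 → Expr 1 → Frame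
  refF loadF : Frame
  storeR  : Expr 0 → Frame
  storeL  : Val → Frame
  randF tapeF : Frame
  randOnR : Expr 0 → Frame
  randOnL : Val → Frame

plug : Frame → Expr 0 → Expr 0
plug (appR e₁)     e = app e₁ e
plug (appL v)      e = app e (val v)
plug (binopR o e₁) e = binop o e₁ e
plug (binopL o v)  e = binop o e (val v)
plug (iteF e₁ e₂)  e = ite e e₁ e₂
plug (pairR e₁)    e = pair e₁ e
plug (pairL v)     e = pair e (val v)
plug fstF          e = fst e
plug sndF          e = snd e
plug inlF          e = inl e
plug inrF          e = inr e
plug (caseF e₁ e₂) e = case e e₁ e₂
plug refF          e = ref e
plug loadF         e = load e
plug (storeR e₁)   e = store e₁ e
plug (storeL v)    e = store e (val v)
plug randF         e = rand e
plug tapeF         e = tape e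
plug (randOnR e₁)  e = randOn e₁ e
plug (randOnL v)   e = randOn e (val v)

under : Frame → Cfg → Cfg
under F (e , σ) = plug F e , σ

plug-running : ∀ F e → value? (plug F e) ≡ nothing
plug-running (appR _)     e = refl
plug-running (appL _)     e = refl
plug-running (binopR _ _) e = refl
plug-running (binopL _ _) e = refl
plug-running (iteF _ _)   e = refl
plug-running (pairR _)    e = refl
plug-running (pairL _)    e = refl
plug-running fstF         e = refl
plug-running sndF         e = refl
plug-running inlF         e = refl
plug-running inrF         e = refl
plug-running (caseF _ _)  e = refl
plug-running refF         e = refl
plug-running loadF        e = refl
plug-running (storeR _)   e = refl
plug-running (storeL _)   e = refl
plug-running randF        e = refl
plug-running tapeF        e = refl
plug-running (randOnR _)  e = refl
plug-running (randOnL _)  e = refl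

next-under : ∀ F ρ → Running ρ → next (under F ρ) ≡ map (λ (p , ρ₁) → p , under F ρ₁) (next ρ)
next-under (appR _)     (e , σ) eq rewrite eq = refl
next-under (appL _)     (e , σ) eq rewrite eq = refl
next-under (binopR _ _) (e , σ) eq rewrite eq = refl
next-under (binopL _ _) (e , σ) eq rewrite eq = refl
next-under (iteF _ _)   (e , σ) eq rewrite eq = refl
next-under (pairR _)    (e , σ) eq rewrite eq = refl
next-under (pairL _)    (e , σ) eq rewrite eq = refl
next-under fstF         (e , σ) eq rewrite eq = refl
next-under sndF         (e , σ) eq rewrite eq = refl
next-under inlF         (e , σ) eq rewrite eq = refl
next-under inrF         (e , σ) eq rewrite eq = refl
next-under (caseF _ _)  (e , σ) eq rewrite eq = refl
next-under refF         (e , σ) eq rewrite eq = refl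
next-under loadF        (e , σ) eq rewrite eq = refl
next-under (storeR _)   (e , σ) eq rewrite eq = refl
next-under (storeL _)   (e , σ) eq rewrite eq = refl
next-under randF        (e , σ) eq rewrite eq = refl
next-under tapeF        (e , σ) eq rewrite eq = refl
next-under (randOnR _)  (e , σ) eq rewrite eq = refl
next-under (randOnL _)  (e , σ) eq rewrite eq = refl

run-under : ∀ F {ρ ρ′} → ρ ↦* ρ′ → under F ρ ↦* under F ρ′
run-under F = Star.gmap (under F) λ where
  (det {e} {σ} nv eq) → det (plug-running F e)
    (trans (next-under F (e , σ) nv) (cong (map _) eq))

fill : List Frame → Expr 0 → Expr 0
fill []       e = e
fill (F ∷ Fs) e = plug F (fill Fs e)

fill-running : ∀ Fs {e} → value? e ≡ nothing → value? (fill Fs e) ≡ nothing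
fill-running []       nv = nv
fill-running (F ∷ Fs) nv = plug-running F _

run-fill : ∀ Fs {e e′ σ σ′} → (e , σ) ↦* (e′ , σ′) → (fill Fs e , σ) ↦* (fill Fs e′ , σ′)
run-fill []       run = run
run-fill (F ∷ Fs) run = run-under F (run-fill Fs run)

next-fill : ∀ Fs e σ → value? e ≡ nothing →
            next (fill Fs e , σ) ≡ map (λ (p , e₁ , σ₁) → p , fill Fs e₁ , σ₁) (next (e , σ))
next-fill []       e σ nv = sym (List.map-id (next (e , σ)))
next-fill (F ∷ Fs) e σ nv =
  trans (next-under F (fill Fs e , σ) (fill-running Fs nv))
    (trans (cong (map _) (next-fill Fs e σ nv)) (sym (List.map-∘ (next (e , σ)))))

next-sample : ∀ Fs z σ → next (fill Fs (rand (int z)) , σ) ≡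
              equally (1/n (bound z)) (λ i → fill Fs (int (+ toℕ i)) , σ)
                      (allFin (suc (bound z)))
next-sample Fs z σ = trans (next-fill Fs (rand (int z)) σ refl)
  (trans (cong (map _) (sym (List.map-∘ (allFin (suc (bound z))))))
         (sym (List.map-∘ (allFin (suc (bound z))))))

record Stuck (ρ : Cfg) : Set where
  constructor dead
  field
    running : Running ρ
    no-step : next ρ ≡ []

stuck-under : ∀ F {ρ} → Stuck ρ → Stuck (under F ρ)
stuck-under F {e , σ} (dead nv eq) =
  dead (plug-running F e) (trans (next-under F (e , σ) nv) (cong (map _) eq))

-- Since `mid` and `mid′` are running, their coupled step takes place inside the hole; a relation
-- closed under the two frames therefore survives plugging.
under-advance : ∀ {R : ℚ → Cfg → Cfg → Set} F F′ →
                (∀ {r ρ ρ′} → R r ρ ρ′ → R r (under F ρ) (under F′ ρ′)) →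
                ∀ {r ρ ρ′} → Advance R r ρ ρ′ → Advance R r (under F ρ) (under F′ ρ′)
under-advance {R} F F′ closed (advance {e , σ} {e′ , σ′} run run′ nv nv′ 0≤ le c) =
  advance (run-under F run) (run-under F′ run′) (plug-running F e) (plug-running F′ e′) 0≤ le
    (subst₂ (Coupling _ _) (sym (next-under F (e , σ) nv)) (sym (next-under F′ (e′ , σ′) nv′))
      (bimap-coupling (λ (ρ₁ , ρ₁′ , s , s′ , rel) →
        under F ρ₁ , under F′ ρ₁′ , run-under F s , run-under F′ s′ , closed rel) c))

-- The deterministic steps of a concrete program are found by evaluating walk in
-- the type checker.
move? : (ρ : Cfg) → Maybe (∃ (ρ ↦_))
move? (e , σ) with value? e in nv | outcomes (step e σ) in eq
... | nothing | (p , ρ) ∷ [] with p ℚ.≟ 1ℚ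
...   | yes refl = just (ρ , det nv eq)
...   | no _     = nothing
move? (e , σ) | _ | _ = nothing

walk : ℕ → Cfg → Cfg
walk zero    ρ = ρ
walk (suc k) ρ = maybe′ (λ (ρ₁ , _) → walk k ρ₁) ρ (move? ρ)

walking : ∀ k {ρ} → ρ ↦* walk k ρ
walking zero        = ε
walking (suc k) {ρ} with move? ρ
... | nothing       = ε
... | just (ρ₁ , s) = s ◅ walking k

-- A lookup in an abstract heap does not compute, so `walking` stops there; this step and the next
-- ones are taken from an equation instead.
load-run : ∀ {l v h t} → lookup h l ≡ just v →
           (load (val (locᵛ l)) , state h t) ↦* (val v , state h t)
load-run eq = det refl (cong (λ m → outcomes (maybe′ _ stuckD m)) eq) ◅ ε

store-run : ∀ {l v w h t} → lookup h l ≡ just v →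
            (store (val (locᵛ l)) (val w) , state h t) ↦* (val unitᵛ , state (insert l w h) t)
store-run {l} {w = w} {h} {t} eq = det refl
  (cong (λ m → outcomes (maybe′ (λ _ → ret (val unitᵛ) (state (insert l w h) t)) stuckD m)) eq) ◅ ε

binop-run : ∀ o v w {u σ} → binOp o v w ≡ just u → (binop o (val v) (val w) , σ) ↦* (val u , σ)
binop-run o v w {σ = σ} eq = det refl (cong (λ m → outcomes (maybe′ (λ u → ret (val u) σ) stuckD m)) eq) ◅ ε

binop-stuck : ∀ o v w {σ} → binOp o v w ≡ nothing → Stuck (binop o (val v) (val w) , σ)
binop-stuck o v w {σ} eq = dead refl (cong (λ m → outcomes (maybe′ (λ u → ret (val u) σ) stuckD m)) eq)

-- Runs of the list functions

length-run : ∀ {A : Set} (f : A → Val) xs {σ} →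
             (app (val lengthᵛ) (val (listᵛ (map f xs))) , σ) ↦* (int (+ length xs) , σ)
length-run f []       = walking 2
length-run f (x ∷ xs) =
  walking 3 ◅◅ run-fill (binopR plus (int (+ 1)) ∷ []) (length-run f xs) ◅◅ walking 1

nth-run : ∀ {A : Set} (f : A → Val) xs i {σ} →
          (app (app (val nthᵛ) (val (listᵛ (map f xs)))) (int (+ toℕ i)) , σ) ↦*
          (val (f (List.lookup xs i)) , σ)
nth-run f (x ∷ xs) zero    = walking 7
nth-run f (x ∷ xs) (suc i) = walking 8 ◅◅ nth-run f xs i

remove-run : ∀ {A : Set} (f : A → Val) xs i {σ} →
             (app (app (val removeᵛ) (val (listᵛ (map f xs)))) (int (+ toℕ i)) , σ) ↦*
             (val (listᵛ (map f (removeAt xs i))) , σ)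
remove-run f (x ∷ xs) zero    = walking 7
remove-run f (x ∷ xs) (suc i) =
  -- `cons` evaluates its tail first, so the head projection is still pending in the frame. The last
  -- three steps are this projection, the pair and the injection.
  walking 8 ◅◅ run-fill (inrF ∷ pairR (fst (val (pairᵛ (f x) (listᵛ (map f xs))))) ∷ []) (remove-run f xs i)
    ◅◅ walking 3

-- Stores and encoded tables

lookup-insert : {A : Set} (l : ℕ) (a : A) (s : Store A) → lookup (insert l a s) l ≡ just a
lookup-insert l a s = cong (λ b → if b then just a else lookup s l) (dec-true (l ℕ.≟ l) refl)

lookup-insert-≢ : {A : Set} {k l : ℕ} {a : A} (s : Store A) {m : Maybe A} →
                  k ≢ l → lookup s l ≡ m → lookup (insert k a s) l ≡ m
lookup-insert-≢ {k = k} {l} {a} s k≢l eq =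
  trans (cong (λ b → if b then just a else lookup s l) (dec-false (k ℕ.≟ l) k≢l)) eq

-- Stated for every location from `fresh s` on, because initially all public cells have to be shown
-- empty at once.
lookup-fresh : {A : Set} (s : Store A) {l : ℕ} → fresh s ℕ.≤ l → lookup s l ≡ nothing
lookup-fresh []            _   = refl
lookup-fresh ((k , a) ∷ s) ≤l =
  lookup-insert-≢ s (ℕ.<⇒≢ (ℕ.≤-trans (ℕ.m≤m⊔n (suc k) (fresh s)) ≤l))
    (lookup-fresh s (ℕ.≤-trans (ℕ.m≤n⊔m (suc k) (fresh s)) ≤l))

num : ∀ {n} → Fin n → Val
num y = intᵛ (+ toℕ y)

entryᵛ : ∀ {n} → Val × Fin n → Val
entryᵛ (x , y) = pairᵛ x (num y)

tableᵛ : ∀ {n} → List (Val × Fin n) → Val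
tableᵛ t = listᵛ (map entryᵛ t)

removeAt-↭ : {A : Set} (xs : List A) (i : Fin (length xs)) → List.lookup xs i ∷ removeAt xs i ↭ xs
removeAt-↭ (x ∷ xs) zero    = Perm.refl
removeAt-↭ (x ∷ xs) (suc i) = Perm.trans (swap _ x Perm.refl) (prep x (removeAt-↭ xs i))

-- The two oracles and the relation between programs

module Game (Q n l₀ : ℕ) where

  ref₀ ref₁ : ∀ {m} → Expr m
  ref₀ = val (locᵛ l₀)
  ref₁ = val (locᵛ (suc l₀))

  rpDraw rfDraw : Expr 3
  rpDraw = lam (let′ (call₂ nthᵛ (load ref₁) (var zero))
    (seq (store ref₀ (extend (load ref₀) (var (suc (suc (suc zero)))) (var zero)))
      (seq (store ref₁ (call₂ removeᵛ (load ref₁) (var (suc zero))))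
        (var zero))))
  rfDraw = lam (seq (store ref₀ (extend (load ref₀) (var (suc (suc zero))) (var zero)))
    (var zero))

  rpᵛ rfᵛ : Val
  rpᵛ = recᵛ (case (call₂ findᵛ (load ref₀) (var zero))
    (app rpDraw (rand (binop minus (call₁ lengthᵛ (load ref₁)) (int (+ 1)))))
    (var zero))
  rfᵛ = recᵛ (case (call₂ findᵛ (load ref₀) (var zero))
    (app rfDraw (rand (binop minus (int (+ suc n)) (int (+ 1)))))
    (var zero))

  boundedBy : ℕ → Val → Expr 2
  boundedBy l f = ite (binop less (load (val (locᵛ l))) (int (+ Q)))
    (seq (store (val (locᵛ l)) (binop plus (load (val (locᵛ l))) (int (+ 1))))
         (some (app (val f) (var zero))))
    none

  rpOracle rfOracle : Expr 2
  rpOracle = boundedBy (suc (suc l₀)) rpᵛ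
  rfOracle = boundedBy (suc l₀) rfᵛ

  -- Beyond the private cells (two on the right, three on the left) the left run
  -- is one location ahead of the right run.
  base : ℕ
  base = 2 ℕ.+ l₀

  infix 4 _≈ᵛ_ _≈_

  mutual
    -- The oracle bodies contain private locations, which `locᵛ` does not relate; the constructor
    -- `oracle` is the only access to them. Labels are equal on both sides because tapes are
    -- allocated in lockstep.
    data _≈ᵛ_ : Val → Val → Set where
      unitᵛ  : unitᵛ ≈ᵛ unitᵛ
      boolᵛ  : ∀ b → boolᵛ b ≈ᵛ boolᵛ b
      intᵛ   : ∀ z → intᵛ z ≈ᵛ intᵛ z
      locᵛ   : ∀ {l} → base ℕ.≤ l → locᵛ (suc l) ≈ᵛ locᵛ l
      lblᵛ   : ∀ ι → lblᵛ ι ≈ᵛ lblᵛ ι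
      recᵛ   : ∀ {e e′} → e ≈ e′ → recᵛ e ≈ᵛ recᵛ e′
      pairᵛ  : ∀ {v v′ w w′} → v ≈ᵛ v′ → w ≈ᵛ w′ → pairᵛ v w ≈ᵛ pairᵛ v′ w′
      inlᵛ   : ∀ {v v′} → v ≈ᵛ v′ → inlᵛ v ≈ᵛ inlᵛ v′
      inrᵛ   : ∀ {v v′} → v ≈ᵛ v′ → inrᵛ v ≈ᵛ inrᵛ v′
      oracle : recᵛ rpOracle ≈ᵛ recᵛ rfOracle

    data _≈_ {m} : Expr m → Expr m → Set where
      val    : ∀ {v v′} → v ≈ᵛ v′ → val v ≈ val v′
      var    : ∀ i → var i ≈ var i
      rec    : ∀ {e e′} → e ≈ e′ → rec e ≈ rec e′
      app    : ∀ {a a′ b b′} → a ≈ a′ → b ≈ b′ → app a b ≈ app a′ b′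
      binop  : ∀ o {a a′ b b′} → a ≈ a′ → b ≈ b′ → binop o a b ≈ binop o a′ b′
      ite    : ∀ {a a′ b b′ c c′} → a ≈ a′ → b ≈ b′ → c ≈ c′ → ite a b c ≈ ite a′ b′ c′
      pair   : ∀ {a a′ b b′} → a ≈ a′ → b ≈ b′ → pair a b ≈ pair a′ b′
      fst    : ∀ {a a′} → a ≈ a′ → fst a ≈ fst a′
      snd    : ∀ {a a′} → a ≈ a′ → snd a ≈ snd a′
      inl    : ∀ {a a′} → a ≈ a′ → inl a ≈ inl a′
      inr    : ∀ {a a′} → a ≈ a′ → inr a ≈ inr a′
      case   : ∀ {a a′ b b′ c c′} → a ≈ a′ → b ≈ b′ → c ≈ c′ → case a b c ≈ case a′ b′ c′
      ref    : ∀ {a a′} → a ≈ a′ → ref a ≈ ref a′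
      load   : ∀ {a a′} → a ≈ a′ → load a ≈ load a′
      store  : ∀ {a a′ b b′} → a ≈ a′ → b ≈ b′ → store a b ≈ store a′ b′
      rand   : ∀ {a a′} → a ≈ a′ → rand a ≈ rand a′
      tape   : ∀ {a a′} → a ≈ a′ → tape a ≈ tape a′
      randOn : ∀ {a a′ b b′} → a ≈ a′ → b ≈ b′ → randOn a b ≈ randOn a′ b′

  data _≈ᵃ_ {m} : Val ⊎ Fin m → Val ⊎ Fin m → Set where
    inj₁ : ∀ {v v′} → v ≈ᵛ v′ → inj₁ v ≈ᵃ inj₁ v′
    inj₂ : ∀ i → inj₂ i ≈ᵃ inj₂ i

  _≈ˢ_ : ∀ {l m} → Sub l m → Sub l m → Set
  s ≈ˢ s′ = ∀ i → s i ≈ᵃ s′ i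

  lift-≈ : ∀ {l m} {s s′ : Sub l m} → s ≈ˢ s′ → lift s ≈ˢ lift s′
  lift-≈ s≈ zero = inj₂ zero
  lift-≈ {s = s} {s′} s≈ (suc i) with s i | s′ i | s≈ i
  ... | _ | _ | inj₁ v≈ = inj₁ v≈
  ... | _ | _ | inj₂ j  = inj₂ (suc j)

  atom-≈ : ∀ {m} {a a′ : Val ⊎ Fin m} → a ≈ᵃ a′ → atom a ≈ atom a′
  atom-≈ (inj₁ v≈) = val v≈
  atom-≈ (inj₂ i)  = var i

  sub-≈ : ∀ {l m} {s s′ : Sub l m} {e e′} → s ≈ˢ s′ → e ≈ e′ → sub s e ≈ sub s′ e′
  sub-≈ s≈ (val v≈)     = val v≈
  sub-≈ s≈ (var i)      = atom-≈ (s≈ i)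
  sub-≈ s≈ (rec a)      = rec (sub-≈ (lift-≈ (lift-≈ s≈)) a)
  sub-≈ s≈ (app a b)    = app (sub-≈ s≈ a) (sub-≈ s≈ b)
  sub-≈ s≈ (binop o a b) = binop o (sub-≈ s≈ a) (sub-≈ s≈ b)
  sub-≈ s≈ (ite a b c)  = ite (sub-≈ s≈ a) (sub-≈ s≈ b) (sub-≈ s≈ c)
  sub-≈ s≈ (pair a b)   = pair (sub-≈ s≈ a) (sub-≈ s≈ b)
  sub-≈ s≈ (fst a)      = fst (sub-≈ s≈ a)
  sub-≈ s≈ (snd a)      = snd (sub-≈ s≈ a)
  sub-≈ s≈ (inl a)      = inl (sub-≈ s≈ a)
  sub-≈ s≈ (inr a)      = inr (sub-≈ s≈ a)
  sub-≈ s≈ (case a b c) = case (sub-≈ s≈ a) (sub-≈ (lift-≈ s≈) b) (sub-≈ (lift-≈ s≈) c)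
  sub-≈ s≈ (ref a)      = ref (sub-≈ s≈ a)
  sub-≈ s≈ (load a)     = load (sub-≈ s≈ a)
  sub-≈ s≈ (store a b)  = store (sub-≈ s≈ a) (sub-≈ s≈ b)
  sub-≈ s≈ (rand a)     = rand (sub-≈ s≈ a)
  sub-≈ s≈ (tape a)     = tape (sub-≈ s≈ a)
  sub-≈ s≈ (randOn a b) = randOn (sub-≈ s≈ a) (sub-≈ s≈ b)

  skip₁-≈ : ∀ {m} → skip₁ {m} ≈ˢ skip₁
  skip₁-≈ zero    = inj₂ zero
  skip₁-≈ (suc i) = inj₂ (suc (suc i))

  lam-≈ : ∀ {m} {e e′ : Expr (suc m)} → e ≈ e′ → lam e ≈ lam e′
  lam-≈ e≈ = rec (sub-≈ skip₁-≈ e≈)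

  weaken-≈ : ∀ {m} {e e′ : Expr m} → e ≈ e′ → weaken e ≈ weaken e′
  weaken-≈ = sub-≈ (λ i → inj₂ (suc i))

  inst₁-≈ : ∀ {v v′} → v ≈ᵛ v′ → inst₁ v ≈ˢ inst₁ v′
  inst₁-≈ v≈ zero = inj₁ v≈

  inst₂-≈ : ∀ {v v′ w w′} → v ≈ᵛ v′ → w ≈ᵛ w′ → inst₂ v w ≈ˢ inst₂ v′ w′
  inst₂-≈ v≈ w≈ zero       = inj₁ v≈
  inst₂-≈ v≈ w≈ (suc zero) = inj₁ w≈

  -- The only use of typing: there is no rule for location literals.
  ⊢⇒≈ : ∀ {Δ m} {Γ : Ctx Δ m} {e τ} → Γ ⊢ e ∶ τ → e ≈ e
  ⊢⇒≈ (⊢var i)        = var i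
  ⊢⇒≈ ⊢unit           = val unitᵛ
  ⊢⇒≈ (⊢bool b)       = val (boolᵛ b)
  ⊢⇒≈ (⊢nat k)        = val (intᵛ (+ k))
  ⊢⇒≈ (⊢int z)        = val (intᵛ z)
  ⊢⇒≈ (⊢nat≤ d)       = ⊢⇒≈ d
  ⊢⇒≈ (⊢natOp o d d′) = binop _ (⊢⇒≈ d) (⊢⇒≈ d′)
  ⊢⇒≈ (⊢intOp o d d′) = binop _ (⊢⇒≈ d) (⊢⇒≈ d′)
  ⊢⇒≈ (⊢cmp o d d′)   = binop _ (⊢⇒≈ d) (⊢⇒≈ d′)
  ⊢⇒≈ (⊢equal _ d d′) = binop _ (⊢⇒≈ d) (⊢⇒≈ d′)
  ⊢⇒≈ (⊢ite d d′ d″)  = ite (⊢⇒≈ d) (⊢⇒≈ d′) (⊢⇒≈ d″)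
  ⊢⇒≈ (⊢rec d)        = rec (⊢⇒≈ d)
  ⊢⇒≈ (⊢recᵛ d)       = val (recᵛ (⊢⇒≈ d))
  ⊢⇒≈ (⊢app d d′)     = app (⊢⇒≈ d) (⊢⇒≈ d′)
  ⊢⇒≈ (⊢pair d d′)    = pair (⊢⇒≈ d) (⊢⇒≈ d′)
  ⊢⇒≈ (⊢pairᵛ d d′) with ⊢⇒≈ d | ⊢⇒≈ d′
  ... | val v≈ | val w≈ = val (pairᵛ v≈ w≈)
  ⊢⇒≈ (⊢fst d)        = fst (⊢⇒≈ d)
  ⊢⇒≈ (⊢snd d)        = snd (⊢⇒≈ d)
  ⊢⇒≈ (⊢inl d)        = inl (⊢⇒≈ d)
  ⊢⇒≈ (⊢inr d)        = inr (⊢⇒≈ d)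
  ⊢⇒≈ (⊢inlᵛ d) with ⊢⇒≈ d
  ... | val v≈        = val (inlᵛ v≈)
  ⊢⇒≈ (⊢inrᵛ d) with ⊢⇒≈ d
  ... | val v≈        = val (inrᵛ v≈)
  ⊢⇒≈ (⊢case d d′ d″) = case (⊢⇒≈ d) (⊢⇒≈ d′) (⊢⇒≈ d″)
  ⊢⇒≈ (⊢tlam d)       = lam-≈ (weaken-≈ (⊢⇒≈ d))
  ⊢⇒≈ (⊢tlamᵛ d)      = val (recᵛ (sub-≈ skip₁-≈ (weaken-≈ (⊢⇒≈ d))))
  ⊢⇒≈ (⊢tapp _ d)     = app (⊢⇒≈ d) (val unitᵛ)
  ⊢⇒≈ (⊢pack _ d)     = ⊢⇒≈ d
  ⊢⇒≈ (⊢unpack d d′)  = app (lam-≈ (⊢⇒≈ d′)) (⊢⇒≈ d)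
  ⊢⇒≈ (⊢fold d)       = ⊢⇒≈ d
  ⊢⇒≈ (⊢unfold d)     = app (lam-≈ (var zero)) (⊢⇒≈ d)
  ⊢⇒≈ (⊢ref d)        = ref (⊢⇒≈ d)
  ⊢⇒≈ (⊢load d)       = load (⊢⇒≈ d)
  ⊢⇒≈ (⊢store d d′)   = store (⊢⇒≈ d) (⊢⇒≈ d′)
  ⊢⇒≈ (⊢rand d)       = rand (⊢⇒≈ d)
  ⊢⇒≈ (⊢tape d)       = tape (⊢⇒≈ d)
  ⊢⇒≈ (⊢randOn d d′)  = randOn (⊢⇒≈ d) (⊢⇒≈ d′)

  -- Invariants of the two heaps

  -- `fresh≡` and `base≤fresh` make the next allocation on both sides return a pair of locations
  -- related by `locᵛ`.
  record Public (h h′ : Store Val) : Set where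
    field
      fresh≡     : fresh h ≡ suc (fresh h′)
      base≤fresh : base ℕ.≤ fresh h′
      cells      : ∀ {l} → base ℕ.≤ l → Maybe.Pointwise _≈ᵛ_ (lookup h (suc l)) (lookup h′ l)

  -- One table describes both maps: keys are related pairs, answers are equal. `used≤` is an
  -- inequality because a repeated query raises the counter without drawing.
  record Private (k : ℕ) (h h′ : Store Val) : Set where
    field
      table       : List ((Val × Val) × Fin (suc n))
      unused used : List (Fin (suc n))
      keys≈       : All (λ ((x , x′) , _) → x ≈ᵛ x′) table
      unused+used : unused ++ used ↭ allFin (suc n)
      used≤       : length used ℕ.≤ k
      tableˡ      : lookup h l₀ ≡ just (tableᵛ (map (Product.map₁ proj₁) table))
      tableʳ      : lookup h′ l₀ ≡ just (tableᵛ (map (Product.map₁ proj₂) table))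
      unusedˡ     : lookup h (suc l₀) ≡ just (listᵛ (map num unused))
      countˡ      : lookup h (suc (suc l₀)) ≡ just (intᵛ (+ k))
      countʳ      : lookup h′ (suc l₀) ≡ just (intᵛ (+ k))

  public-insert : ∀ {l v v′ h h′} → base ℕ.≤ l → v ≈ᵛ v′ → Public h h′ →
                  Public (insert (suc l) v h) (insert l v′ h′)
  public-insert {l} {v} {v′} base≤l v≈ pub = record
    { fresh≡     = cong (suc (suc l) ℕ.⊔_) fresh≡
    ; base≤fresh = ℕ.≤-trans base≤fresh (ℕ.m≤n⊔m (suc l) _)
    ; cells      = λ {l′} base≤l′ → choose (does (l ℕ.≟ l′)) (cells base≤l′)
    }
    where
    open Public pub
    choose : ∀ b {m m′} → Maybe.Pointwise _≈ᵛ_ m m′ →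
             Maybe.Pointwise _≈ᵛ_ (if b then just v else m) (if b then just v′ else m′)
    choose true  _  = just v≈
    choose false m≈ = m≈

  -- The location `base` itself is allowed: on the left it is the third private cell, and the public
  -- ones start after it. On the right it is already public.
  private-insertˡ : ∀ {l v h h′} → l ℕ.≤ base → Public h h′ → Public (insert l v h) h′
  private-insertˡ {l} {v} {h} l≤base pub = record
    { fresh≡     = trans (ℕ.m≤n⇒m⊔n≡n
        (ℕ.≤-trans (s≤s (ℕ.≤-trans l≤base base≤fresh)) (ℕ.≤-reflexive (sym fresh≡)))) fresh≡
    ; base≤fresh = base≤fresh
    ; cells      = λ base≤l′ → subst (λ m → Maybe.Pointwise _≈ᵛ_ m _)
        (sym (lookup-insert-≢ h (ℕ.<⇒≢ (s≤s (ℕ.≤-trans l≤base base≤l′))) refl)) (cells base≤l′)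
    }
    where open Public pub

  private-insertʳ : ∀ {l v h h′} → l ℕ.< base → Public h h′ → Public h (insert l v h′)
  private-insertʳ {l} {v} {h} {h′} l<base pub = record
    { fresh≡     = trans fresh≡ (cong suc (sym fresh≡fresh))
    ; base≤fresh = ℕ.≤-trans base≤fresh (ℕ.≤-reflexive (sym fresh≡fresh))
    ; cells      = λ base≤l′ → subst (Maybe.Pointwise _≈ᵛ_ _)
        (sym (lookup-insert-≢ h′ (ℕ.<⇒≢ (ℕ.≤-trans l<base base≤l′)) refl)) (cells base≤l′)
    }
    where
    open Public pub
    fresh≡fresh : suc l ℕ.⊔ fresh h′ ≡ fresh h′
    fresh≡fresh = ℕ.m≤n⇒m⊔n≡n (ℕ.≤-trans l<base base≤fresh)

  private-frame : ∀ {k l v v′ h h′} → base ℕ.≤ l → Private k h h′ →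
                  Private k (insert (suc l) v h) (insert l v′ h′)
  private-frame {l = l} {h = h} {h′} base≤l priv = record
    { Private priv
    ; tableˡ  = lookup-insert-≢ h (distinct l₀ (s≤s (ℕ.m≤n+m l₀ 2))) tableˡ
    ; tableʳ  = lookup-insert-≢ h′ (ℕ.<⇒≢ (ℕ.≤-trans (ℕ.n≤1+n (suc l₀)) base≤l) ∘ sym) tableʳ
    ; unusedˡ = lookup-insert-≢ h (distinct (suc l₀) (s≤s (ℕ.n≤1+n (suc l₀)))) unusedˡ
    ; countˡ  = lookup-insert-≢ h (distinct (suc (suc l₀)) ℕ.≤-refl) countˡ
    ; countʳ  = lookup-insert-≢ h′ (ℕ.<⇒≢ base≤l ∘ sym) countʳ
    }
    where
    open Private priv
    distinct : ∀ i → i ℕ.< suc base → suc l ≢ i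
    distinct i i<base = ℕ.<⇒≢ (ℕ.≤-trans i<base (s≤s base≤l)) ∘ sym

  record States (k : ℕ) (σ σ′ : State) : Set where
    constructor states
    field
      shared   : Public (heap σ) (heap σ′)
      secret   : Private k (heap σ) (heap σ′)
      tapes≡   : tapes σ ≡ tapes σ′

  Budget : ℚ → ℕ → Set
  Budget r k = ∃ λ d → k ℕ.+ d ≡ Q × r ≡ budget n d k

  budget≥0 : ∀ {r k} → Budget r k → 0ℚ ℚ.≤ r
  budget≥0 {k = k} (d , _ , refl) = budget-nonNeg n d k

  data Related (r : ℚ) : Cfg → Cfg → Set where
    related : ∀ {k e e′ σ σ′} → Budget r k → e ≈ e′ → States k σ σ′ → Related r (e , σ) (e′ , σ′)

  Lock : ℚ → SubDist Cfg → SubDist Cfg → Set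
  Lock r μ ν = Coupling (Eventually (Related r)) 0ℚ (outcomes μ) (outcomes ν)

  -- On locations the common shift by one computes away, and functions cannot be compared, so the
  -- oracle is never told apart this way. Equality of the booleans is what lets the two map searches
  -- take the same branch.
  equal-≈ : ∀ {v v′ w w′} → v ≈ᵛ v′ → w ≈ᵛ w′ →
            Maybe.Pointwise (λ u u′ → ∃ λ b → u ≡ boolᵛ b × u′ ≡ boolᵛ b)
              (binOp equal v w) (binOp equal v′ w′)
  equal-≈ unitᵛ unitᵛ = just (_ , refl , refl)
  equal-≈ unitᵛ (boolᵛ _) = nothing
  equal-≈ unitᵛ (intᵛ _) = nothing
  equal-≈ unitᵛ (locᵛ _) = nothing
  equal-≈ unitᵛ (lblᵛ _) = nothing
  equal-≈ unitᵛ (recᵛ _) = nothing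
  equal-≈ unitᵛ (pairᵛ _ _) = nothing
  equal-≈ unitᵛ (inlᵛ _) = nothing
  equal-≈ unitᵛ (inrᵛ _) = nothing
  equal-≈ unitᵛ oracle = nothing
  equal-≈ (boolᵛ _) unitᵛ = nothing
  equal-≈ (boolᵛ _) (boolᵛ _) = just (_ , refl , refl)
  equal-≈ (boolᵛ _) (intᵛ _) = nothing
  equal-≈ (boolᵛ _) (locᵛ _) = nothing
  equal-≈ (boolᵛ _) (lblᵛ _) = nothing
  equal-≈ (boolᵛ _) (recᵛ _) = nothing
  equal-≈ (boolᵛ _) (pairᵛ _ _) = nothing
  equal-≈ (boolᵛ _) (inlᵛ _) = nothing
  equal-≈ (boolᵛ _) (inrᵛ _) = nothing
  equal-≈ (boolᵛ _) oracle = nothing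
  equal-≈ (intᵛ _) unitᵛ = nothing
  equal-≈ (intᵛ _) (boolᵛ _) = nothing
  equal-≈ (intᵛ _) (intᵛ _) = just (_ , refl , refl)
  equal-≈ (intᵛ _) (locᵛ _) = nothing
  equal-≈ (intᵛ _) (lblᵛ _) = nothing
  equal-≈ (intᵛ _) (recᵛ _) = nothing
  equal-≈ (intᵛ _) (pairᵛ _ _) = nothing
  equal-≈ (intᵛ _) (inlᵛ _) = nothing
  equal-≈ (intᵛ _) (inrᵛ _) = nothing
  equal-≈ (intᵛ _) oracle = nothing
  equal-≈ (locᵛ _) unitᵛ = nothing
  equal-≈ (locᵛ _) (boolᵛ _) = nothing
  equal-≈ (locᵛ _) (intᵛ _) = nothing
  equal-≈ (locᵛ _) (locᵛ _) = just (_ , refl , refl)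
  equal-≈ (locᵛ _) (lblᵛ _) = nothing
  equal-≈ (locᵛ _) (recᵛ _) = nothing
  equal-≈ (locᵛ _) (pairᵛ _ _) = nothing
  equal-≈ (locᵛ _) (inlᵛ _) = nothing
  equal-≈ (locᵛ _) (inrᵛ _) = nothing
  equal-≈ (locᵛ _) oracle = nothing
  equal-≈ (lblᵛ _) _ = nothing
  equal-≈ (recᵛ _) _ = nothing
  equal-≈ (pairᵛ _ _) _ = nothing
  equal-≈ (inlᵛ _) _ = nothing
  equal-≈ (inrᵛ _) _ = nothing
  equal-≈ oracle _ = nothing

  intOp-≈ : ∀ o a b → Maybe.Pointwise _≈ᵛ_ (intOp o a b) (intOp o a b)
  intOp-≈ plus  a b          = just (intᵛ _)
  intOp-≈ minus a b          = just (intᵛ _)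
  intOp-≈ times a b          = just (intᵛ _)
  intOp-≈ div   a (+ 0)      = nothing
  intOp-≈ div   a +[1+ _ ]   = just (intᵛ _)
  intOp-≈ div   a -[1+ _ ]   = just (intᵛ _)
  intOp-≈ mod   a (+ 0)      = nothing
  intOp-≈ mod   a +[1+ _ ]   = just (intᵛ _)
  intOp-≈ mod   a -[1+ _ ]   = just (intᵛ _)
  intOp-≈ less  a b          = just (boolᵛ _)
  intOp-≈ leq   a b          = just (boolᵛ _)
  intOp-≈ equal a b          = just (boolᵛ _)

  binOp-≈ : ∀ o {v v′ w w′} → v ≈ᵛ v′ → w ≈ᵛ w′ → Maybe.Pointwise _≈ᵛ_ (binOp o v w) (binOp o v′ w′)
  binOp-≈ equal {v} {v′} {w} {w′} v≈ w≈ with binOp equal v w | binOp equal v′ w′ | equal-≈ v≈ w≈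
  ... | _ | _ | nothing                  = nothing
  ... | _ | _ | just (b , refl , refl)   = just (boolᵛ b)
  binOp-≈ o (intᵛ a) (intᵛ b) = intOp-≈ o a b
  binOp-≈ plus unitᵛ _ = nothing
  binOp-≈ minus unitᵛ _ = nothing
  binOp-≈ times unitᵛ _ = nothing
  binOp-≈ div unitᵛ _ = nothing
  binOp-≈ mod unitᵛ _ = nothing
  binOp-≈ less unitᵛ _ = nothing
  binOp-≈ leq unitᵛ _ = nothing
  binOp-≈ plus (boolᵛ _) _ = nothing
  binOp-≈ minus (boolᵛ _) _ = nothing
  binOp-≈ times (boolᵛ _) _ = nothing
  binOp-≈ div (boolᵛ _) _ = nothing
  binOp-≈ mod (boolᵛ _) _ = nothing
  binOp-≈ less (boolᵛ _) _ = nothing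
  binOp-≈ leq (boolᵛ _) _ = nothing
  binOp-≈ o (intᵛ _) unitᵛ = nothing
  binOp-≈ o (intᵛ _) (boolᵛ _) = nothing
  binOp-≈ o (intᵛ _) (locᵛ _) = nothing
  binOp-≈ o (intᵛ _) (lblᵛ _) = nothing
  binOp-≈ o (intᵛ _) (recᵛ _) = nothing
  binOp-≈ o (intᵛ _) (pairᵛ _ _) = nothing
  binOp-≈ o (intᵛ _) (inlᵛ _) = nothing
  binOp-≈ o (intᵛ _) (inrᵛ _) = nothing
  binOp-≈ o (intᵛ _) oracle = nothing
  binOp-≈ plus (locᵛ _) _ = nothing
  binOp-≈ minus (locᵛ _) _ = nothing
  binOp-≈ times (locᵛ _) _ = nothing
  binOp-≈ div (locᵛ _) _ = nothing
  binOp-≈ mod (locᵛ _) _ = nothing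
  binOp-≈ less (locᵛ _) _ = nothing
  binOp-≈ leq (locᵛ _) _ = nothing
  binOp-≈ o (lblᵛ _) _ = nothing
  binOp-≈ o (recᵛ _) _ = nothing
  binOp-≈ o (pairᵛ _ _) _ = nothing
  binOp-≈ o (inlᵛ _) _ = nothing
  binOp-≈ o (inrᵛ _) _ = nothing
  binOp-≈ o oracle _ = nothing

  -- Head reductions in lockstep

  module _ {r k} (b : Budget r k) {σ σ′} (s : States k σ σ′) where
    open States s

    ret-≈ : ∀ {e e′} → e ≈ e′ → Lock r (ret e σ) (ret e′ σ′)
    ret-≈ e≈ = dret-coupling (_ , _ , ε , ε , related b e≈ s)

    binopH-≈ : ∀ o {v v′ w w′} → v ≈ᵛ v′ → w ≈ᵛ w′ → Lock r (binopH o v w σ) (binopH o v′ w′ σ′)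
    binopH-≈ o {v} {v′} {w} {w′} v≈ w≈ with binOp o v w | binOp o v′ w′ | binOp-≈ o v≈ w≈
    ... | _ | _ | nothing = empty-coupling
    ... | _ | _ | just u≈ = ret-≈ (val u≈)

    iteH-≈ : ∀ {v v′ e₁ e₁′ e₂ e₂′} → v ≈ᵛ v′ → e₁ ≈ e₁′ → e₂ ≈ e₂′ →
             Lock r (iteH v e₁ e₂ σ) (iteH v′ e₁′ e₂′ σ′)
    iteH-≈ (boolᵛ true)  e₁≈ e₂≈ = ret-≈ e₁≈
    iteH-≈ (boolᵛ false) e₁≈ e₂≈ = ret-≈ e₂≈
    iteH-≈ unitᵛ       _ _ = empty-coupling
    iteH-≈ (intᵛ _)    _ _ = empty-coupling
    iteH-≈ (locᵛ _)    _ _ = empty-coupling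
    iteH-≈ (lblᵛ _)    _ _ = empty-coupling
    iteH-≈ (recᵛ _)    _ _ = empty-coupling
    iteH-≈ (pairᵛ _ _) _ _ = empty-coupling
    iteH-≈ (inlᵛ _)    _ _ = empty-coupling
    iteH-≈ (inrᵛ _)    _ _ = empty-coupling
    iteH-≈ oracle      _ _ = empty-coupling

    fstH-≈ : ∀ {v v′} → v ≈ᵛ v′ → Lock r (fstH v σ) (fstH v′ σ′)
    fstH-≈ (pairᵛ v≈ w≈) = ret-≈ (val v≈)
    fstH-≈ unitᵛ       = empty-coupling
    fstH-≈ (boolᵛ _)   = empty-coupling
    fstH-≈ (intᵛ _)    = empty-coupling
    fstH-≈ (locᵛ _)    = empty-coupling
    fstH-≈ (lblᵛ _)    = empty-coupling
    fstH-≈ (recᵛ _)    = empty-coupling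
    fstH-≈ (inlᵛ _)    = empty-coupling
    fstH-≈ (inrᵛ _)    = empty-coupling
    fstH-≈ oracle      = empty-coupling

    sndH-≈ : ∀ {v v′} → v ≈ᵛ v′ → Lock r (sndH v σ) (sndH v′ σ′)
    sndH-≈ (pairᵛ v≈ w≈) = ret-≈ (val w≈)
    sndH-≈ unitᵛ       = empty-coupling
    sndH-≈ (boolᵛ _)   = empty-coupling
    sndH-≈ (intᵛ _)    = empty-coupling
    sndH-≈ (locᵛ _)    = empty-coupling
    sndH-≈ (lblᵛ _)    = empty-coupling
    sndH-≈ (recᵛ _)    = empty-coupling
    sndH-≈ (inlᵛ _)    = empty-coupling
    sndH-≈ (inrᵛ _)    = empty-coupling
    sndH-≈ oracle      = empty-coupling

    caseH-≈ : ∀ {v v′ e₁ e₁′ e₂ e₂′} → v ≈ᵛ v′ → e₁ ≈ e₁′ → e₂ ≈ e₂′ →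
              Lock r (caseH v e₁ e₂ σ) (caseH v′ e₁′ e₂′ σ′)
    caseH-≈ (inlᵛ v≈) e₁≈ e₂≈ = ret-≈ (sub-≈ (inst₁-≈ v≈) e₁≈)
    caseH-≈ (inrᵛ v≈) e₁≈ e₂≈ = ret-≈ (sub-≈ (inst₁-≈ v≈) e₂≈)
    caseH-≈ unitᵛ       _ _ = empty-coupling
    caseH-≈ (boolᵛ _)   _ _ = empty-coupling
    caseH-≈ (intᵛ _)    _ _ = empty-coupling
    caseH-≈ (locᵛ _)    _ _ = empty-coupling
    caseH-≈ (lblᵛ _)    _ _ = empty-coupling
    caseH-≈ (recᵛ _)    _ _ = empty-coupling
    caseH-≈ (pairᵛ _ _) _ _ = empty-coupling
    caseH-≈ oracle      _ _ = empty-coupling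

    refH-≈ : ∀ {v v′} → v ≈ᵛ v′ → Lock r (refH v σ) (refH v′ σ′)
    refH-≈ v≈ rewrite Public.fresh≡ shared = dret-coupling (_ , _ , ε , ε ,
      related b (val (locᵛ base≤fresh))
        (states (public-insert base≤fresh v≈ shared) (private-frame base≤fresh secret) tapes≡))
      where open Public shared

    loadH-≈ : ∀ {v v′} → v ≈ᵛ v′ → Lock r (loadH v σ) (loadH v′ σ′)
    loadH-≈ (locᵛ {l} base≤l) with lookup (heap σ) (suc l) | lookup (heap σ′) l | Public.cells shared base≤l
    ... | _ | _ | nothing = empty-coupling
    ... | _ | _ | just v≈ = ret-≈ (val v≈)
    loadH-≈ unitᵛ       = empty-coupling
    loadH-≈ (boolᵛ _)   = empty-coupling
    loadH-≈ (intᵛ _)    = empty-coupling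
    loadH-≈ (lblᵛ _)    = empty-coupling
    loadH-≈ (recᵛ _)    = empty-coupling
    loadH-≈ (pairᵛ _ _) = empty-coupling
    loadH-≈ (inlᵛ _)    = empty-coupling
    loadH-≈ (inrᵛ _)    = empty-coupling
    loadH-≈ oracle      = empty-coupling

    storeH-≈ : ∀ {v v′ w w′} → v ≈ᵛ v′ → w ≈ᵛ w′ → Lock r (storeH v w σ) (storeH v′ w′ σ′)
    storeH-≈ (locᵛ {l} base≤l) w≈
      with lookup (heap σ) (suc l) | lookup (heap σ′) l | Public.cells shared base≤l
    ... | _ | _ | nothing = empty-coupling
    ... | _ | _ | just _  = dret-coupling (_ , _ , ε , ε , related b (val unitᵛ)
      (states (public-insert base≤l w≈ shared) (private-frame base≤l secret) tapes≡))
    storeH-≈ unitᵛ       _ = empty-coupling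
    storeH-≈ (boolᵛ _)   _ = empty-coupling
    storeH-≈ (intᵛ _)    _ = empty-coupling
    storeH-≈ (lblᵛ _)    _ = empty-coupling
    storeH-≈ (recᵛ _)    _ = empty-coupling
    storeH-≈ (pairᵛ _ _) _ = empty-coupling
    storeH-≈ (inlᵛ _)    _ = empty-coupling
    storeH-≈ (inrᵛ _)    _ = empty-coupling
    storeH-≈ oracle      _ = empty-coupling

    sample-≈ : ∀ N → Lock r (sample N σ) (sample N σ′)
    sample-≈ N = subst₂ (Coupling _ 0ℚ) (List.map-∘ (allFin (suc N))) (List.map-∘ (allFin (suc N)))
      (equally-coupling (allFin (suc N)) (0≤1/n N)
        (ℚ.≤-reflexive (trans (cong (_⋆ 1/n N) (List.length-tabulate {n = suc N} id)) (n⋆1/n N)))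
        (λ i → _ , _ , ε , ε , related b (val (intᵛ _)) s))

    randH-≈ : ∀ {v v′} → v ≈ᵛ v′ → Lock r (randH v σ) (randH v′ σ′)
    randH-≈ (intᵛ z) = sample-≈ (bound z)
    randH-≈ unitᵛ       = empty-coupling
    randH-≈ (boolᵛ _)   = empty-coupling
    randH-≈ (locᵛ _)    = empty-coupling
    randH-≈ (lblᵛ _)    = empty-coupling
    randH-≈ (recᵛ _)    = empty-coupling
    randH-≈ (pairᵛ _ _) = empty-coupling
    randH-≈ (inlᵛ _)    = empty-coupling
    randH-≈ (inrᵛ _)    = empty-coupling
    randH-≈ oracle      = empty-coupling

    insertTape : ∀ ι (t : Tape) → States k (state (heap σ) (insert ι t (tapes σ)))
                                         (state (heap σ′) (insert ι t (tapes σ′)))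
    insertTape ι t = states shared secret (cong (insert ι t) tapes≡)

    tapeH-≈ : ∀ {v v′} → v ≈ᵛ v′ → Lock r (tapeH v σ) (tapeH v′ σ′)
    tapeH-≈ (intᵛ z) = dret-coupling (_ , _ , ε , ε , related b
      (subst (λ ι → val (lblᵛ (fresh (tapes σ))) ≈ val (lblᵛ ι)) (cong fresh tapes≡) (val (lblᵛ _)))
      (states shared secret (cong (λ t → insert (fresh t) (bound z , []) t) tapes≡)))
    tapeH-≈ unitᵛ       = empty-coupling
    tapeH-≈ (boolᵛ _)   = empty-coupling
    tapeH-≈ (locᵛ _)    = empty-coupling
    tapeH-≈ (lblᵛ _)    = empty-coupling
    tapeH-≈ (recᵛ _)    = empty-coupling
    tapeH-≈ (pairᵛ _ _) = empty-coupling
    tapeH-≈ (inlᵛ _)    = empty-coupling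
    tapeH-≈ (inrᵛ _)    = empty-coupling
    tapeH-≈ oracle      = empty-coupling

    readTape-≈ : ∀ N ι t → Lock r (readTape N ι t σ) (readTape N ι t σ′)
    readTape-≈ N ι nothing = empty-coupling
    readTape-≈ N ι (just (M , ns)) with does (M ℕ.≟ N)
    ... | false = empty-coupling
    readTape-≈ N ι (just (M , []))     | true = sample-≈ N
    readTape-≈ N ι (just (M , i ∷ ns)) | true =
      dret-coupling (_ , _ , ε , ε , related b (val (intᵛ _)) (insertTape ι (M , ns)))

    randOnH-≈ : ∀ {v v′ w w′} → v ≈ᵛ v′ → w ≈ᵛ w′ → Lock r (randOnH v w σ) (randOnH v′ w′ σ′)
    randOnH-≈ (intᵛ z) (lblᵛ ι) =
      subst (λ t → Lock r (readTape N ι (lookup (tapes σ) ι) σ) (readTape N ι (lookup t ι) σ′)) tapes≡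
        (readTape-≈ N ι (lookup (tapes σ) ι))
      where N = bound z
    randOnH-≈ unitᵛ       _ = empty-coupling
    randOnH-≈ (boolᵛ _)   _ = empty-coupling
    randOnH-≈ (locᵛ _)    _ = empty-coupling
    randOnH-≈ (lblᵛ _)    _ = empty-coupling
    randOnH-≈ (recᵛ _)    _ = empty-coupling
    randOnH-≈ (pairᵛ _ _) _ = empty-coupling
    randOnH-≈ (inlᵛ _)    _ = empty-coupling
    randOnH-≈ (inrᵛ _)    _ = empty-coupling
    randOnH-≈ oracle      _ = empty-coupling
    randOnH-≈ (intᵛ _) unitᵛ       = empty-coupling
    randOnH-≈ (intᵛ _) (boolᵛ _)   = empty-coupling
    randOnH-≈ (intᵛ _) (intᵛ _)    = empty-coupling
    randOnH-≈ (intᵛ _) (locᵛ _)    = empty-coupling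
    randOnH-≈ (intᵛ _) (recᵛ _)    = empty-coupling
    randOnH-≈ (intᵛ _) (pairᵛ _ _) = empty-coupling
    randOnH-≈ (intᵛ _) (inlᵛ _)    = empty-coupling
    randOnH-≈ (intᵛ _) (inrᵛ _)    = empty-coupling
    randOnH-≈ (intᵛ _) oracle      = empty-coupling

  lock-advance : ∀ {r e e′ σ σ′} → 0ℚ ℚ.≤ r → value? e ≡ nothing → value? e′ ≡ nothing →
                 Lock r (step e σ) (step e′ σ′) → Advance Related r (e , σ) (e′ , σ′)
  lock-advance 0≤r nv nv′ lock = advance ε ε nv nv′ 0≤r (ℚ.≤-reflexive (ℚ.+-identityˡ _)) lock

  advance-after : ∀ {R : ℚ → Cfg → Cfg → Set} {r ρ ρ₁ ρ′ ρ₁′} →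
                  ρ ↦* ρ₁ → ρ′ ↦* ρ₁′ → Advance R r ρ₁ ρ₁′ → Advance R r ρ ρ′
  advance-after s s′ (advance run run′ nv nv′ 0≤ le c) = advance (s ◅◅ run) (s′ ◅◅ run′) nv nv′ 0≤ le c

  advance-weaken : ∀ {R : ℚ → Cfg → Cfg → Set} {q r ρ ρ′} → q ℚ.≤ r → Advance R q ρ ρ′ → Advance R r ρ ρ′
  advance-weaken q≤r (advance run run′ nv nv′ 0≤ le c) = advance run run′ nv nv′ 0≤ (ℚ.≤-trans le q≤r) c

  stuck-advance : ∀ {R : ℚ → Cfg → Cfg → Set} {r ρ ρ′} → 0ℚ ℚ.≤ r → Stuck ρ → Stuck ρ′ → Advance R r ρ ρ′
  stuck-advance 0≤r (dead nv eq) (dead nv′ eq′) = advance ε ε nv nv′ 0≤r (ℚ.≤-reflexive (ℚ.+-identityˡ _))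
    (subst₂ (Coupling _ _) (sym eq) (sym eq′) empty-coupling)

  -- Oracle calls

  -- The searches leave the heaps unchanged. `crash` is the case of a key that cannot be compared
  -- with the argument, such as a function.
  data Found (σ σ′ : State) (ρ ρ′ : Cfg) : Set where
    crash   : ∀ {ρ₁ ρ₁′} → ρ ↦* ρ₁ → Stuck ρ₁ → ρ′ ↦* ρ₁′ → Stuck ρ₁′ → Found σ σ′ ρ ρ′
    absent  : ρ ↦* (val (inlᵛ unitᵛ) , σ) → ρ′ ↦* (val (inlᵛ unitᵛ) , σ′) → Found σ σ′ ρ ρ′
    present : ∀ z → ρ ↦* (val (inrᵛ (intᵛ z)) , σ) → ρ′ ↦* (val (inrᵛ (intᵛ z)) , σ′) → Found σ σ′ ρ ρ′

  found-after : ∀ {σ σ′ ρ ρ₁ ρ′ ρ₁′} → ρ ↦* ρ₁ → ρ′ ↦* ρ₁′ → Found σ σ′ ρ₁ ρ₁′ → Found σ σ′ ρ ρ′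
  found-after s s′ (crash run st run′ st′) = crash (s ◅◅ run) st (s′ ◅◅ run′) st′
  found-after s s′ (absent run run′)       = absent (s ◅◅ run) (s′ ◅◅ run′)
  found-after s s′ (present z run run′)    = present z (s ◅◅ run) (s′ ◅◅ run′)

  find : List (Val × Fin (suc n)) → Val → Expr 0
  find t x = app (app (val findᵛ) (val (tableᵛ t))) (val x)

  find-≈ : ∀ {table x x′ σ σ′} → All (λ ((k , k′) , _) → k ≈ᵛ k′) table → x ≈ᵛ x′ →
           Found σ σ′ (find (map (Product.map₁ proj₁) table) x , σ)
                      (find (map (Product.map₁ proj₂) table) x′ , σ′)
  find-≈ [] x≈ = absent (walking 5) (walking 5)
  find-≈ {((k , k′) , y) ∷ table} {x} {x′} (k≈ ∷ keys≈) x≈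
    with binOp equal k x in eq | binOp equal k′ x′ in eq′ | equal-≈ k≈ x≈
  ... | _ | _ | nothing = crash
    (walking 6) (stuck-under (iteF _ _) (binop-stuck equal k x eq))
    (walking 6) (stuck-under (iteF _ _) (binop-stuck equal k′ x′ eq′))
  ... | _ | _ | just (true , refl , refl) = present (+ toℕ y)
    (walking 6 ◅◅ run-fill (iteF _ _ ∷ []) (binop-run equal k x eq) ◅◅ walking 4)
    (walking 6 ◅◅ run-fill (iteF _ _ ∷ []) (binop-run equal k′ x′ eq′) ◅◅ walking 4)
  ... | _ | _ | just (false , refl , refl) = found-after
    (walking 6 ◅◅ run-fill (iteF _ _ ∷ []) (binop-run equal k x eq) ◅◅ walking 2)
    (walking 6 ◅◅ run-fill (iteF _ _ ∷ []) (binop-run equal k′ x′ eq′) ◅◅ walking 2)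
    (find-≈ keys≈ x≈)

  less-true : ∀ {k} → k ℕ.< Q → binOp less (intᵛ (+ k)) (intᵛ (+ Q)) ≡ just (boolᵛ true)
  less-true {k} k<Q rewrite dec-true (+ k ℤ.<? + Q) (ℤ.+<+ k<Q) = refl

  less-false : ∀ {k} → Q ℕ.≤ k → binOp less (intᵛ (+ k)) (intᵛ (+ Q)) ≡ just (boolᵛ false)
  less-false {k} Q≤k rewrite dec-false (+ k ℤ.<? + Q) (ℤ.≤⇒≯ (ℤ.+≤+ Q≤k)) = refl

  plus-one : ∀ k → binOp plus (intᵛ (+ k)) (intᵛ (+ 1)) ≡ just (intᵛ (+ suc k))
  plus-one k rewrite ℕ.+-comm k 1 = refl

  -- Stops below the pending `inr`, with the counter already raised, so that the call of the
  -- underlying function can be treated on its own and framed afterwards.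
  admit-run : ∀ {k l f x h t} → k ℕ.< Q → lookup h l ≡ just (intᵛ (+ k)) →
              (app (val (recᵛ (boundedBy l f))) (val x) , state h t) ↦*
              (inr (app (val f) (val x)) , state (insert l (intᵛ (+ suc k)) h) t)
  admit-run {k} {l} {f} k<Q count =
    walking 1
    ◅◅ run-fill (iteF _ _ ∷ binopL less _ ∷ []) (load-run count)
    ◅◅ run-fill (iteF _ _ ∷ []) (binop-run less (intᵛ (+ k)) (intᵛ (+ Q)) (less-true k<Q))
    ◅◅ walking 1
    ◅◅ run-fill (appR _ ∷ storeR _ ∷ binopL plus _ ∷ []) (load-run count)
    ◅◅ run-fill (appR _ ∷ storeR _ ∷ []) (binop-run plus (intᵛ (+ k)) (intᵛ (+ 1)) (plus-one k))
    ◅◅ run-fill (appR _ ∷ []) (store-run count)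
    ◅◅ walking 2

  refuse-run : ∀ {k l f x h t} → Q ℕ.≤ k → lookup h l ≡ just (intᵛ (+ k)) →
               (app (val (recᵛ (boundedBy l f))) (val x) , state h t) ↦* (none , state h t)
  refuse-run {k} Q≤k count =
    walking 1
    ◅◅ run-fill (iteF _ _ ∷ binopL less _ ∷ []) (load-run count)
    ◅◅ run-fill (iteF _ _ ∷ []) (binop-run less (intᵛ (+ k)) (intᵛ (+ Q)) (less-false Q≤k))
    ◅◅ walking 1

  l₀≢1+l₀ : l₀ ≢ suc l₀
  l₀≢1+l₀ = ℕ.<⇒≢ ℕ.≤-refl

  l₀≢2+l₀ : l₀ ≢ suc (suc l₀)
  l₀≢2+l₀ = ℕ.<⇒≢ (ℕ.n≤1+n (suc l₀))

  1+l₀≢2+l₀ : suc l₀ ≢ suc (suc l₀)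
  1+l₀≢2+l₀ = ℕ.<⇒≢ ℕ.≤-refl

  private-count : ∀ {k h h′} → Private k h h′ →
                  Private (suc k) (insert (suc (suc l₀)) (intᵛ (+ suc k)) h)
                                  (insert (suc l₀) (intᵛ (+ suc k)) h′)
  private-count {h = h} {h′} priv = record
    { Private priv
    ; used≤   = ℕ.m≤n⇒m≤1+n used≤
    ; tableˡ  = lookup-insert-≢ h (l₀≢2+l₀ ∘ sym) tableˡ
    ; tableʳ  = lookup-insert-≢ h′ (l₀≢1+l₀ ∘ sym) tableʳ
    ; unusedˡ = lookup-insert-≢ h (1+l₀≢2+l₀ ∘ sym) unusedˡ
    ; countˡ  = lookup-insert (suc (suc l₀)) _ h
    ; countʳ  = lookup-insert (suc l₀) _ h′
    }
    where open Private priv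

  -- The shape that reduction leaves behind: the call substitutes the argument and the function,
  -- then the miss branch its unit payload.
  afterMiss : Expr 3 → Val → Val → Expr 0
  afterMiss e f x = sub (inst₁ unitᵛ) (sub (lift (inst₂ x f)) e)

  rp-draw-run : ∀ {h t x} table (unused : List (Fin (suc n))) (i : Fin (length unused)) →
                lookup h l₀ ≡ just (tableᵛ table) →
                lookup h (suc l₀) ≡ just (listᵛ (map num unused)) →
                let y = List.lookup unused i in
                (app (afterMiss rpDraw rpᵛ x) (int (+ toℕ i)) , state h t) ↦*
                (val (num y) ,
                 state (insert (suc l₀) (listᵛ (map num (removeAt unused i)))
                          (insert l₀ (tableᵛ ((x , y) ∷ table)) h)) t)
  rp-draw-run {h} table unused i table≡ unused≡ =
    walking 2
    ◅◅ run-fill (appR _ ∷ appL _ ∷ appR _ ∷ []) (load-run unused≡)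
    ◅◅ run-fill (appR _ ∷ []) (nth-run num unused i)
    ◅◅ walking 2
    ◅◅ run-fill (appR _ ∷ storeR _ ∷ inrF ∷ pairR _ ∷ []) (load-run table≡)
    ◅◅ walking 3
    ◅◅ run-fill (appR _ ∷ []) (store-run table≡)
    ◅◅ walking 2
    ◅◅ run-fill (appR _ ∷ storeR _ ∷ appL _ ∷ appR _ ∷ []) (load-run unused≡′)
    ◅◅ run-fill (appR _ ∷ storeR _ ∷ []) (remove-run num unused i)
    ◅◅ run-fill (appR _ ∷ []) (store-run unused≡′)
    ◅◅ walking 2
    where unused≡′ = lookup-insert-≢ h l₀≢1+l₀ unused≡

  rf-draw-run : ∀ {h t x} table (y : Fin (suc n)) → lookup h l₀ ≡ just (tableᵛ table) →
                (app (afterMiss rfDraw rfᵛ x) (int (+ toℕ y)) , state h t) ↦*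
                (val (num y) , state (insert l₀ (tableᵛ ((x , y) ∷ table)) h) t)
  rf-draw-run table y table≡ =
    walking 2
    ◅◅ run-fill (appR _ ∷ storeR _ ∷ inrF ∷ pairR _ ∷ []) (load-run table≡)
    ◅◅ walking 3
    ◅◅ run-fill (appR _ ∷ []) (store-run table≡)
    ◅◅ walking 2

  module _ {k σ σ′} (s : States (suc k) σ σ′) where
    open States s
    open Private secret

    states-draw : ∀ {x x′} → length used ℕ.≤ k → x ≈ᵛ x′ → (i : Fin (length unused)) →
                  let y = List.lookup unused i in
                  States (suc k)
                    (state (insert (suc l₀) (listᵛ (map num (removeAt unused i)))
                             (insert l₀ (tableᵛ ((x , y) ∷ map (Product.map₁ proj₁) table)) (heap σ)))
                           (tapes σ))
                    (state (insert l₀ (tableᵛ ((x′ , y) ∷ map (Product.map₁ proj₂) table)) (heap σ′))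
                           (tapes σ′))
    states-draw {x} {x′} used≤k x≈ i = states
      (private-insertˡ (ℕ.n≤1+n (suc l₀)) (private-insertˡ (ℕ.m≤n+m l₀ 2)
        (private-insertʳ (ℕ.n≤1+n (suc l₀)) shared)))
      (record
        { table       = ((x , x′) , y) ∷ table
        ; unused      = removeAt unused i
        ; used        = y ∷ used
        ; keys≈       = x≈ ∷ keys≈
        ; unused+used = Perm.trans (Perm.shift y (removeAt unused i) used)
                          (Perm.trans (Perm.++⁺ʳ used (removeAt-↭ unused i)) unused+used)
        ; used≤       = s≤s used≤k
        ; tableˡ      = lookup-insert-≢ (insert l₀ T (heap σ)) (l₀≢1+l₀ ∘ sym) (lookup-insert l₀ T (heap σ))
        ; tableʳ      = lookup-insert l₀ _ (heap σ′)
        ; unusedˡ     = lookup-insert (suc l₀) _ (insert l₀ T (heap σ))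
        ; countˡ      = lookup-insert-≢ (insert l₀ T (heap σ)) 1+l₀≢2+l₀
                          (lookup-insert-≢ (heap σ) l₀≢2+l₀ countˡ)
        ; countʳ      = lookup-insert-≢ (heap σ′) l₀≢1+l₀ countʳ
        })
      tapes≡
      where
      y = List.lookup unused i
      T = tableᵛ ((x , y) ∷ map (Product.map₁ proj₁) table)

  -- With no unused value left the left run gets stuck, but then all N values are
  -- used and the allowed loss is at least 1.
  sample-coupling : ∀ {R : Cfg → Cfg → Set} (unused used : List (Fin (suc n))) →
                    unused ++ used ↭ allFin (suc n) →
                    ∀ {e e′ σ σ′} →
                    (∀ i → R (app e (int (+ toℕ i)) , σ) (app e′ (int (+ toℕ (List.lookup unused i))) , σ′)) →
                    Coupling R (length used ⋆ 1/n n)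
                      (next (app e (rand (int (+ length unused ℤ.- + 1))) , σ))
                      (next (app e′ (rand (int (+ n))) , σ′))
  sample-coupling [] used perm {e} {e′} {σ} {σ′} rel =
    -- The bound -1 counts as 0, so the draw itself succeeds; it is `nthᵛ` on the empty list that
    -- gets stuck later.
    unmatched (step (app e (rand (int (+ 0 ℤ.- + 1)))) σ) (step (app e′ (rand (int (+ n)))) σ′)
      (ℚ.≤-reflexive (sym (trans (cong (_⋆ 1/n n)
        (trans (Perm.↭-length perm) (List.length-tabulate {n = suc n} id))) (n⋆1/n n))))
  sample-coupling {R} unused@(_ ∷ us) used perm {e} {e′} {σ} {σ′} rel =
    subst₂ (Coupling R _)
      (sym (next-sample (appR e ∷ []) (+ length us) σ)) (sym (next-sample (appR e′ ∷ []) (+ n) σ′))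
      (draw-coupling unused used refl perm _ _ λ i →
        subst (λ j → R (app e (int (+ toℕ i)) , σ) (app e′ (int (+ toℕ (List.lookup unused j))) , σ′))
          (sym (Fin.cast-is-id refl i)) (rel i))

  -- The counter already shows k + 1, but the draw must be charged for the at most k values used
  -- before it; hence the separate bound on `used`.
  query-advance : ∀ {k q r σ σ′ x x′} (s : States (suc k) σ σ′) → length (Private.used (States.secret s)) ℕ.≤ k →
                  Budget q (suc k) → k ⋆ 1/n n ℚ.+ q ℚ.≤ r → x ≈ᵛ x′ →
                  Advance Related r (app (val rpᵛ) (val x) , σ) (app (val rfᵛ) (val x′) , σ′)
  query-advance {k} {q} {r} {σ} {σ′} {x} {x′} s used≤k b k⋆a+q≤r x≈ =
    advance-after
      (walking 1 ◅◅ run-fill (caseF _ _ ∷ appL _ ∷ appR _ ∷ []) (load-run tableˡ))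
      (walking 1 ◅◅ run-fill (caseF _ _ ∷ appL _ ∷ appR _ ∷ []) (load-run tableʳ))
      (found (find-≈ keys≈ x≈))
    where
    open States s
    open Private secret

    q≤r : q ℚ.≤ r
    q≤r = ℚ.≤-trans (ℚ.≤-trans (ℚ.≤-reflexive (sym (ℚ.+-identityˡ q)))
      (ℚ.+-monoˡ-≤ q (⋆-nonNeg k (0≤1/n n)))) k⋆a+q≤r

    found : ∀ {f f′} → Found σ σ′ (f , σ) (f′ , σ′) →
            Advance Related r
              (case f (app (sub (lift (inst₂ x rpᵛ)) rpDraw)
                           (rand (binop minus (call₁ lengthᵛ (load ref₁)) (int (+ 1))))) (var zero) , σ)
              (case f′ (app (sub (lift (inst₂ x′ rfᵛ)) rfDraw)
                            (rand (binop minus (int (+ suc n)) (int (+ 1))))) (var zero) , σ′)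
    found (crash run dead₁ run′ dead₁′) = advance-after
      (run-under (caseF _ _) run) (run-under (caseF _ _) run′)
      (stuck-advance (ℚ.≤-trans (budget≥0 b) q≤r) (stuck-under (caseF _ _) dead₁) (stuck-under (caseF _ _) dead₁′))
    -- A repeated query draws nothing, and its share k/N of the error is given up.
    found (present z run run′) = advance-weaken q≤r (advance-after
      (run-under (caseF _ _) run) (run-under (caseF _ _) run′)
      (lock-advance (budget≥0 b) refl refl (ret-≈ b s (val (intᵛ z)))))
    found (absent run run′) = advance
      (run-under (caseF _ _) run ◅◅ walking 1
        ◅◅ run-fill (appR _ ∷ randF ∷ binopL minus _ ∷ appR _ ∷ []) (load-run unusedˡ)
        ◅◅ run-fill (appR _ ∷ randF ∷ binopL minus _ ∷ []) (length-run num unused)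
        ◅◅ walking 1)
      (run-under (caseF _ _) run′ ◅◅ walking 2)
      refl refl (budget≥0 b)
      -- The draw loses the number of used values over N, which is at most the share k/N.
      (ℚ.≤-trans (ℚ.+-monoˡ-≤ q (⋆-monoˡ-≤ (0≤1/n n) used≤k)) k⋆a+q≤r)
      (sample-coupling unused used unused+used {afterMiss rpDraw rpᵛ x} {afterMiss rfDraw rfᵛ x′}
        λ i → _ , _ , rp-draw-run (map (Product.map₁ proj₁) table) unused i tableˡ unusedˡ ,
                rf-draw-run (map (Product.map₁ proj₂) table) (List.lookup unused i) tableʳ ,
              related b (val (intᵛ _)) (states-draw s used≤k x≈ i))

  -- Related configurations advance

  data Split : Expr 0 → Expr 0 → Set where
    values  : ∀ {v v′} → v ≈ᵛ v′ → Split (val v) (val v′)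
    running : ∀ {e e′} → value? e ≡ nothing → value? e′ ≡ nothing → Split e e′

  split : ∀ {e e′} → e ≈ e′ → Split e e′
  split (val v≈)      = values v≈
  split (rec _)       = running refl refl
  split (app _ _)     = running refl refl
  split (binop _ _ _) = running refl refl
  split (ite _ _ _)   = running refl refl
  split (pair _ _)    = running refl refl
  split (fst _)       = running refl refl
  split (snd _)       = running refl refl
  split (inl _)       = running refl refl
  split (inr _)       = running refl refl
  split (case _ _ _)  = running refl refl
  split (ref _)       = running refl refl
  split (load _)      = running refl refl
  split (store _ _)   = running refl refl
  split (rand _)      = running refl refl
  split (tape _)      = running refl refl
  split (randOn _ _)  = running refl refl

  frame-advance : ∀ F F′ → (∀ {e e′} → e ≈ e′ → plug F e ≈ plug F′ e′) →
                  ∀ {r ρ ρ′} → Advance Related r ρ ρ′ → Advance Related r (under F ρ) (under F′ ρ′)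
  frame-advance F F′ plug-≈ = under-advance F F′ λ where
    (related b e≈ s) → related b (plug-≈ e≈) s

  oracle-advance : ∀ {r k σ σ′ x x′} → Budget r k → States k σ σ′ → x ≈ᵛ x′ →
                   Advance Related r (app (val (recᵛ rpOracle)) (val x) , σ)
                                     (app (val (recᵛ rfOracle)) (val x′) , σ′)
  oracle-advance {k = k} (d , k+d≡Q , refl) s x≈ with k ℕ.<? Q
  ... | no k≮Q = advance-after (refuse-run (ℕ.≮⇒≥ k≮Q) countˡ) (refuse-run (ℕ.≮⇒≥ k≮Q) countʳ)
    (lock-advance (budget-nonNeg n d k) refl refl (ret-≈ (d , k+d≡Q , refl) s (val (inlᵛ unitᵛ))))
    where open Private (States.secret s)
  oracle-advance {k = k} (zero , k+d≡Q , refl) s x≈ | yes k<Q =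
    contradiction (trans (sym (ℕ.+-identityʳ k)) k+d≡Q) (ℕ.<⇒≢ k<Q)
  oracle-advance {k = k} (suc d , k+d≡Q , refl) s x≈ | yes k<Q =
    advance-after (admit-run k<Q countˡ) (admit-run k<Q countʳ)
      (frame-advance inrF inrF inr
        (query-advance
          (states (private-insertˡ ℕ.≤-refl (private-insertʳ ℕ.≤-refl shared)) (private-count secret) tapes≡)
          -- The error unfolds to k/N plus the budget of the remaining d queries, so the required
          -- inequality is an equality by computation.
          used≤ (d , trans (sym (ℕ.+-suc k d)) k+d≡Q , refl) ℚ.≤-refl x≈))
    where
    open States s
    open Private secret

  module _ {r k} (b : Budget r k) {σ σ′} (s : States k σ σ′) where
    lock : ∀ {e e′} → value? e ≡ nothing → value? e′ ≡ nothing →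
           Lock r (step e σ) (step e′ σ′) → Advance Related r (e , σ) (e′ , σ′)
    lock = lock-advance (budget≥0 b)

    app-advance : ∀ {v v′ w w′} → v ≈ᵛ v′ → w ≈ᵛ w′ →
                  Advance Related r (app (val v) (val w) , σ) (app (val v′) (val w′) , σ′)
    app-advance (recᵛ e≈)   w≈ = lock refl refl (ret-≈ b s (sub-≈ (inst₂-≈ w≈ (recᵛ e≈)) e≈))
    app-advance oracle      w≈ = oracle-advance b s w≈
    app-advance unitᵛ       _  = lock refl refl empty-coupling
    app-advance (boolᵛ _)   _  = lock refl refl empty-coupling
    app-advance (intᵛ _)    _  = lock refl refl empty-coupling
    app-advance (locᵛ _)    _  = lock refl refl empty-coupling
    app-advance (lblᵛ _)    _  = lock refl refl empty-coupling
    app-advance (pairᵛ _ _) _  = lock refl refl empty-coupling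
    app-advance (inlᵛ _)    _  = lock refl refl empty-coupling
    app-advance (inrᵛ _)    _  = lock refl refl empty-coupling

    -- The recursion follows the evaluation order down to the redex and lifts its advance back
    -- through the frames. Only an oracle call is not a single lockstep reduction.
    advance-≈ : ∀ {e e′} → e ≈ e′ → value? e ≡ nothing → Advance Related r (e , σ) (e′ , σ′)
    advance-≈ (rec a) _ = lock refl refl (ret-≈ b s (val (recᵛ a)))
    advance-≈ (app a c) _ with split c
    ... | running nv _ = frame-advance (appR _) (appR _) (app a) (advance-≈ c nv)
    ... | values w≈ with split a
    ...   | running nv _ = frame-advance (appL _) (appL _) (λ a → app a (val w≈)) (advance-≈ a nv)
    ...   | values v≈    = app-advance v≈ w≈
    advance-≈ (binop o a c) _ with split c
    ... | running nv _ = frame-advance (binopR o _) (binopR o _) (binop o a) (advance-≈ c nv)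
    ... | values w≈ with split a
    ...   | running nv _ = frame-advance (binopL o _) (binopL o _) (λ a → binop o a (val w≈)) (advance-≈ a nv)
    ...   | values v≈    = lock refl refl (binopH-≈ b s o v≈ w≈)
    advance-≈ (ite a c d) _ with split a
    ... | running nv _ = frame-advance (iteF _ _) (iteF _ _) (λ a → ite a c d) (advance-≈ a nv)
    ... | values v≈    = lock refl refl (iteH-≈ b s v≈ c d)
    advance-≈ (pair a c) _ with split c
    ... | running nv _ = frame-advance (pairR _) (pairR _) (pair a) (advance-≈ c nv)
    ... | values w≈ with split a
    ...   | running nv _ = frame-advance (pairL _) (pairL _) (λ a → pair a (val w≈)) (advance-≈ a nv)
    ...   | values v≈    = lock refl refl (ret-≈ b s (val (pairᵛ v≈ w≈)))
    advance-≈ (fst a) _ with split a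
    ... | running nv _ = frame-advance fstF fstF fst (advance-≈ a nv)
    ... | values v≈    = lock refl refl (fstH-≈ b s v≈)
    advance-≈ (snd a) _ with split a
    ... | running nv _ = frame-advance sndF sndF snd (advance-≈ a nv)
    ... | values v≈    = lock refl refl (sndH-≈ b s v≈)
    advance-≈ (inl a) _ with split a
    ... | running nv _ = frame-advance inlF inlF inl (advance-≈ a nv)
    ... | values v≈    = lock refl refl (ret-≈ b s (val (inlᵛ v≈)))
    advance-≈ (inr a) _ with split a
    ... | running nv _ = frame-advance inrF inrF inr (advance-≈ a nv)
    ... | values v≈    = lock refl refl (ret-≈ b s (val (inrᵛ v≈)))
    advance-≈ (case a c d) _ with split a
    ... | running nv _ = frame-advance (caseF _ _) (caseF _ _) (λ a → case a c d) (advance-≈ a nv)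
    ... | values v≈    = lock refl refl (caseH-≈ b s v≈ c d)
    advance-≈ (ref a) _ with split a
    ... | running nv _ = frame-advance refF refF ref (advance-≈ a nv)
    ... | values v≈    = lock refl refl (refH-≈ b s v≈)
    advance-≈ (load a) _ with split a
    ... | running nv _ = frame-advance loadF loadF load (advance-≈ a nv)
    ... | values v≈    = lock refl refl (loadH-≈ b s v≈)
    advance-≈ (store a c) _ with split c
    ... | running nv _ = frame-advance (storeR _) (storeR _) (store a) (advance-≈ c nv)
    ... | values w≈ with split a
    ...   | running nv _ = frame-advance (storeL _) (storeL _) (λ a → store a (val w≈)) (advance-≈ a nv)
    ...   | values v≈    = lock refl refl (storeH-≈ b s v≈ w≈)
    advance-≈ (rand a) _ with split a
    ... | running nv _ = frame-advance randF randF rand (advance-≈ a nv)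
    ... | values v≈    = lock refl refl (randH-≈ b s v≈)
    advance-≈ (tape a) _ with split a
    ... | running nv _ = frame-advance tapeF tapeF tape (advance-≈ a nv)
    ... | values v≈    = lock refl refl (tapeH-≈ b s v≈)
    advance-≈ (randOn a c) _ with split c
    ... | running nv _ = frame-advance (randOnR _) (randOnR _) (randOn a) (advance-≈ c nv)
    ... | values w≈ with split a
    ...   | running nv _ = frame-advance (randOnL _) (randOnL _) (λ a → randOn a (val w≈)) (advance-≈ a nv)
    ...   | values v≈    = lock refl refl (randOnH-≈ b s v≈ w≈)

  -- Related values may differ, but only inside locations and functions, and never in whether they
  -- are a given boolean.
  pointMass-≈ : ∀ {v v′} → v ≈ᵛ v′ → ∀ b → pointMass v (boolᵛ b) ≡ pointMass v′ (boolᵛ b)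
  pointMass-≈ unitᵛ       _ = refl
  pointMass-≈ (boolᵛ _)   _ = refl
  pointMass-≈ (intᵛ _)    _ = refl
  pointMass-≈ (locᵛ _)    _ = refl
  pointMass-≈ (lblᵛ _)    _ = refl
  pointMass-≈ (recᵛ _)    _ = refl
  pointMass-≈ (pairᵛ _ _) _ = refl
  pointMass-≈ (inlᵛ _)    _ = refl
  pointMass-≈ (inrᵛ _)    _ = refl
  pointMass-≈ oracle      _ = refl

  execₙ-val : ∀ n v σ w → execₙ n (val v , σ) w ≡ pointMass v w
  execₙ-val zero    v σ w = refl
  execₙ-val (suc n) v σ w = refl

  simulation : ∀ b → Simulation (boolᵛ b) Related
  simulation b = record
    { error-nonNeg = λ where (related budget _ _) → budget≥0 budget
    ; progress     = λ where (related budget e≈ s) → progress budget e≈ s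
    }
    where
    progress : ∀ {r k e e′ σ σ′} → Budget r k → e ≈ e′ → States k σ σ′ →
               Agree (boolᵛ b) (e , σ) (e′ , σ′) ⊎ Advance Related r (e , σ) (e′ , σ′)
    progress {σ = σ} {σ′} budget e≈ s with split e≈
    ... | running nv _ = inj₂ (advance-≈ budget s e≈ nv)
    ... | values {v} {v′} v≈ = inj₁ λ n → trans (execₙ-val n v σ (boolᵛ b))
      (trans (pointMass-≈ v≈ b) (sym (execₙ-val n v′ σ′ (boolᵛ b))))

  -- Initialisation

  -- The location is a parameter constrained by an equation, so that the runs below mention `l₀` and
  -- its successors instead of nested `fresh` terms.
  ref-run : ∀ {l v h t} → fresh h ≡ l → (ref (val v) , state h t) ↦* (val (locᵛ l) , state (insert l v h) t)
  ref-run refl = walking 1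

  fresh-insert : ∀ {A : Set} {l} (a : A) s → fresh s ≡ l → fresh (insert l a s) ≡ suc l
  fresh-insert {l = l} a s fresh≡ = ℕ.m≥n⇒m⊔n≡m (ℕ.≤-trans (ℕ.≤-reflexive fresh≡) (ℕ.n≤1+n l))

  unusedᵛ : Val
  unusedᵛ = listᵛ (map (λ i → intᵛ (+ i)) (upTo (suc n)))

  tabulate-toℕ : ∀ {A : Set} (f : ℕ → A) m → List.tabulate {n = m} (f ∘ toℕ) ≡ List.applyUpTo f m
  tabulate-toℕ f zero    = refl
  tabulate-toℕ f (suc m) = cong (f 0 ∷_) (tabulate-toℕ (f ∘ suc) m)

  -- The program builds its list from natural numbers, whereas the invariant speaks of elements of
  -- `Fin`.
  unusedᵛ-allFin : unusedᵛ ≡ listᵛ (map num (allFin (suc n)))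
  unusedᵛ-allFin = cong listᵛ (trans (List.map-applyUpTo id (λ i → intᵛ (+ i)) (suc n))
    (sym (trans (List.map-tabulate {n = suc n} id num) (tabulate-toℕ (λ i → intᵛ (+ i)) (suc n)))))

  module _ (h : Store Val) (fresh≡ : fresh h ≡ l₀) where

    rp₁ rp₂ rp₃ rf₂ : Store Val
    rp₁ = insert l₀ nilᵛ h
    rp₂ = insert (suc l₀) unusedᵛ rp₁
    rp₃ = insert (suc (suc l₀)) (intᵛ (+ 0)) rp₂
    rf₂ = insert (suc l₀) (intᵛ (+ 0)) rp₁

    fresh₁ : fresh rp₁ ≡ suc l₀
    fresh₁ = fresh-insert nilᵛ h fresh≡

    fresh₂ : fresh rp₂ ≡ suc (suc l₀)
    fresh₂ = fresh-insert unusedᵛ rp₁ fresh₁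

    fresh₃ : fresh rp₃ ≡ suc (suc (suc l₀))
    fresh₃ = fresh-insert (intᵛ (+ 0)) rp₂ fresh₂

    fresh₂′ : fresh rf₂ ≡ suc (suc l₀)
    fresh₂′ = fresh-insert (intᵛ (+ 0)) rp₁ fresh₁

    -- Arguments are evaluated first: the inner oracle allocates before the counter does, and both
    -- are ready before the adversary takes a step.
    rp-init-run : ∀ A {t} → (app A (bounded Q (rp (suc n))) , state h t) ↦*
                            (app A (val (recᵛ rpOracle)) , state rp₃ t)
    rp-init-run A = run-fill (appR A ∷ [])
      (run-fill (appR _ ∷ appR _ ∷ []) (ref-run fresh≡)
       ◅◅ walking 2
       ◅◅ run-fill (appR _ ∷ appR _ ∷ []) (ref-run fresh₁)
       ◅◅ walking 5
       ◅◅ run-fill (appR _ ∷ []) (ref-run fresh₂)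
       ◅◅ walking 3)

    rf-init-run : ∀ A {t} → (app A (bounded Q (rf (suc n))) , state h t) ↦*
                            (app A (val (recᵛ rfOracle)) , state rf₂ t)
    rf-init-run A = run-fill (appR A ∷ [])
      (run-fill (appR _ ∷ appR _ ∷ []) (ref-run fresh≡)
       ◅◅ walking 5
       ◅◅ run-fill (appR _ ∷ []) (ref-run fresh₁)
       ◅◅ walking 3)

    -- The cells of the given heap lie below `l₀` and those just allocated are private, so every
    -- public cell is still empty on both sides.
    init-states : ∀ t → States 0 (state rp₃ t) (state rf₂ t)
    init-states t = states
      (record
        { fresh≡     = trans fresh₃ (cong suc (sym fresh₂′))
        ; base≤fresh = ℕ.≤-reflexive (sym fresh₂′)
        ; cells      = λ {l} base≤l → subst₂ (Maybe.Pointwise _≈ᵛ_)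
            (sym (lookup-fresh rp₃ (ℕ.≤-trans (ℕ.≤-reflexive fresh₃) (s≤s base≤l))))
            (sym (lookup-fresh rf₂ (ℕ.≤-trans (ℕ.≤-reflexive fresh₂′) base≤l)))
            nothing
        })
      (record
        { table       = []
        ; unused      = allFin (suc n)
        ; used        = []
        ; keys≈       = []
        ; unused+used = Perm.↭-reflexive (List.++-identityʳ (allFin (suc n)))
        ; used≤       = z≤n
        ; tableˡ      = lookup-insert-≢ rp₂ (l₀≢2+l₀ ∘ sym)
                          (lookup-insert-≢ rp₁ (l₀≢1+l₀ ∘ sym) (lookup-insert l₀ nilᵛ h))
        ; tableʳ      = lookup-insert-≢ rp₁ (l₀≢1+l₀ ∘ sym) (lookup-insert l₀ nilᵛ h)
        ; unusedˡ     = lookup-insert-≢ rp₂ (1+l₀≢2+l₀ ∘ sym)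
                          (trans (lookup-insert (suc l₀) unusedᵛ rp₁) (cong just unusedᵛ-allFin))
        ; countˡ      = lookup-insert (suc (suc l₀)) _ rp₂
        ; countʳ      = lookup-insert (suc l₀) _ rp₁
        })
      refl

    init-related : ∀ {A t} → A ≈ A → Related (budget n Q 0)
                     (app A (val (recᵛ rpOracle)) , state rp₃ t) (app A (val (recᵛ rfOracle)) , state rf₂ t)
    init-related A≈A = related (Q , refl , refl) (app A≈A (val oracle)) (init-states _)

-- From finite indices to the limit

-- A rational below the left limit is below some term of index n; the term of index m on the right
-- then witnesses the shifted cut.
exec-≤ᴸ : ∀ {e e′ σ σ′ v r} → (∀ n → ∃ λ m → execₙ n (e , σ) v ℚ.≤ execₙ m (e′ , σ′) v ℚ.+ r) →
          exec e σ v ≤ᴸ exec e′ σ′ v +ᴸ r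
exec-≤ᴸ {e′ = e′} {σ′ = σ′} {v} {r} bounds q (n , q<execₙ) = let m , execₙ≤ = bounds n in
  m , subst (q ℚ.- r ℚ.<_) (solve 2 (λ x r → x :+ r :- r := x) refl (execₙ m (e′ , σ′) v) r)
        (ℚ.+-monoˡ-< (ℚ.- r) (ℚ.<-≤-trans q<execₙ execₙ≤))
  where open ℚ-Solver.+-*-Solver

run-bound : ∀ {v R r ρ₀ ρ ρ₀′ ρ′} → Simulation v R → ρ₀ ↦* ρ → ρ₀′ ↦* ρ′ → R r ρ ρ′ →
            ∀ n → ∃ λ m → execₙ n ρ₀ v ℚ.≤ execₙ m ρ₀′ v ℚ.+ r
run-bound {v} {r = r} sim run run′ rel n =
  let m , h  = simulation-bound sim n rel
      M , h′ = execₙ-run-≥ m v run′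
  in M , ℚ.≤-trans (execₙ-run-≤ n v run) (ℚ.≤-trans h (ℚ.+-monoˡ-≤ r h′))

lemma2p1 : (Q N : ℕ) .{{_ : NonZero N}} →
    (A : Expr 0) → ClosedOfType A ((intᵗ ⇒ option intᵗ) ⇒ boolᵗ) →
    (σ : State) →
    ∣ exec (app A (bounded Q (rp N))) σ (boolᵛ true)
    − exec (app A (bounded Q (rf N))) σ (boolᵛ true)
    ∣≤ _/_ (+ Q ℤ.* (+ Q ℤ.- + 1)) (2 ℕ.* N) {{m*n≢0 2 N}}
lemma2p1 Q zero    A ⊢A σ = contradiction refl (ℕ.≢-nonZero⁻¹ 0)
lemma2p1 Q (suc n) A ⊢A σ =
  subst (λ r → ∣ exec (app A (bounded Q (rp (suc n)))) σ (boolᵛ true)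
               − exec (app A (bounded Q (rf (suc n)))) σ (boolᵛ true) ∣≤ r)
    (budget-total n Q)
    ( exec-≤ᴸ (run-bound (simulation true) runˡ runʳ rel)
    , exec-≤ᴸ (run-bound (flip-simulation (simulation true)) runʳ runˡ rel))
  where
  open Game Q n (fresh (heap σ))
  runˡ = rp-init-run (heap σ) refl A
  runʳ = rf-init-run (heap σ) refl A
  rel  = init-related (heap σ) refl (⊢⇒≈ ⊢A)
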